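{- For all integers $a\geq 2$ and all $n\geq 503$, \[\mathrm{ex}_{\Pi}\Bigl(n, 6, \tbinom{6}{2}a +7\Bigr) = \Pi_{2,1}(a,n).\]
   Context: A multigraph is a pair $G=(V,w)$ where $V$ is a finite set and $w:\binom{V}{2}\to\mathbb{Z}_{\geq 0}$. For $X\subseteq V$ write $e(G[X])=\sum_{xy\in\binom{X}{2}}w(xy)$ and $P(G)=\prod_{xy\in\binom{V}{2}}w(xy)$. Given integers $s\geq 2$, $q\geq 0$, $\mathcal{F}(n,s,q)$ denotes the set of multigraphs on vertex set $[n]=\{1,\dots,n\}$ in which every $s$-set $X$ of vertices satisfies $e(G[X])\leq q$, and $\mathrm{ex}_{\Pi}(n,s,q)=\max\{P(G): G\in\mathcal{F}(n,s,q)\}$. For positive integers $a,r$, $d\in\{0,\dots,a-1\}$ and $n$, $\mathcal{T}_{r,d}(a,n)$ is the set of multigraphs $G$ on $[n]$ whose vertex set can be partitioned into $r$ parts $V_0,\dots,V_{r-1}$ such that all pairs inside $V_0$ have multiplicity $a-d$, all pairs inside $V_i$ ($1\le i\le r-1$) have multiplicity $a$, and all other pairs have multiplicity $a+1$. $\Pi_{r,d}(a,n)=\max\{P(G):G\in\mathcal{T}_{r,d}(a,n)\}$. -}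

module Defs where

open import Data.Nat using (ℕ; zero; suc; _+_; _*_; _∸_; _≤_)
open import Data.Bool using (Bool; true; false; _∧_; if_then_else_)
open import Data.Fin using (Fin; _<?_; _≟_) renaming (_<_ to _<ᶠ_)
open import Data.Fin.Subset using (Subset; ∣_∣)
open import Data.Vec using (lookup)
open import Data.List using (List; map; filter; concatMap; allFin)
open import Data.Nat.ListAction using (sum; product)
open import Data.Product using (_×_; _,_; Σ; ∃; ∃-syntax)
open import Relation.Binary.PropositionalEquality using (_≡_)
open import Relation.Nullary.Decidable using (does)

-- A multigraph on [n] = Fin n.  The multiplicity of the pair {i,j} (i < j)
-- is  w i j ; the values w i j with i ≥ j are never used.
Multigraph : ℕ → Set
Multigraph n = Fin n → Fin n → ℕ

pairs : (n : ℕ) → List (Fin n × Fin n)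
pairs n = concatMap (λ i → map (i ,_) (filter (λ j → i <? j) (allFin n))) (allFin n)

P : {n : ℕ} → Multigraph n → ℕ
P {n} w = product (map (λ { (i , j) → w i j }) (pairs n))

e : {n : ℕ} → Multigraph n → Subset n → ℕ
e {n} w X = sum (map (λ { (i , j) → if lookup X i ∧ lookup X j then w i j else 0 }) (pairs n))

InF : (n s q : ℕ) → Multigraph n → Set
InF n s q w = (X : Subset n) → ∣ X ∣ ≡ s → e w X ≤ q

partWeight : {r : ℕ} → (a d : ℕ) → Fin r → Fin r → ℕ
partWeight a d Fin.zero Fin.zero = a ∸ d
partWeight a d k l = if does (k ≟ l) then a else suc a

-- G ∈ 𝓣_{r,d}(a,n): a partition of [n] into parts V_0,…,V_{r-1}
-- (given by the part-assignment map Fin n → Fin r) realising the weights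
InT : (r d a n : ℕ) → Multigraph n → Set
InT r d a n w = Σ (Fin n → Fin r) λ part → ((i j : Fin n) → i <ᶠ j →
                            w i j ≡ partWeight {r} a d (part i) (part j))

IsMaxP : {n : ℕ} → (Multigraph n → Set) → ℕ → Set
IsMaxP S v = (∃[ w ] (S w × P w ≡ v)) × (∀ w → S w → P w ≤ v)

{-# OPTIONS --safe #-}
module Submission where

-- Write c = w − a for the (signed) excess of a weight over a, so that 6-sets have total excess at
-- most 7, and w ≤ a ((a + 1) / a) ^ c for every weight w.  Induct on the number n of vertices.
--
-- If some vertex has total excess at most n / 4 + 1, delete it: the extremal product grows by at
-- least as much, since the parts satisfy either k ≥ n / 4 + 1 (add a vertex to V₁) or
-- n ∸ k ∸ 7k / 4 ≥ n / 4 + 1 (add a vertex to V₀), in view of (a ∸ 1)⁴ (a + 1)⁷ ≥ a¹¹.  For small n,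
-- where this comparison fails, one keeps instead an exponent n² / 8 + O(n), which is beaten by the
-- extremal one when n is large.
--
-- Otherwise all degrees are at least τ > n / 4 + 1.  Then 4-sets, 3-sets and pairs have excess at
-- most 3, 2 and 1: a heavier set X either sends too little weight outside, or forces an outside
-- vertex of small degree.  So the edges H of excess 1 are triangle-free, and every 4-cycle of H has
-- a diagonal in L, the set of pairs of negative excess.  A vertex with fewer than τ ∸ 1 L-neighbours
-- has an L-clique as H-neighbourhood; hence the vertices with at least τ ∸ 1 L-neighbours form an
-- L-clique (this is V₀) and the remaining ones span no edge of H.

open import Defs

-- Integer inequalities behind the counting arguments

module IntegerArithmetic where

  open import Data.Empty using (⊥)
  open import Data.Integer
  open import Data.Integer.Properties using (≤-trans; +-mono-≤; pos-*; i≤j⇒0≤j-i; 0≤i-j⇒j≤i; ≰⇒>; i<j⇒suc[i]≤j)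
  open import Data.Integer.Tactic.RingSolver using (solve)
  open import Data.List using ([]; _∷_)
  open import Data.Nat using (z≤n)
  open import Function using (_∘_)
  open import Relation.Binary.PropositionalEquality using (_≡_; refl; subst)
  open import Relation.Nullary using (¬_)

  -- Inequalities are proved from certificates: a nonnegative combination of the gaps of the
  -- hypotheses, built with ⊞ and ⊠, equals -1 (absurd) or the gap of the conclusion (by).
  infixl 6 _⊞_
  infixl 7 _⊠_

  gap : ∀ {i j} → i ≤ j → 0ℤ ≤ j - i
  gap = i≤j⇒0≤j-i

  _⊞_ : ∀ {i j} → 0ℤ ≤ i → 0ℤ ≤ j → 0ℤ ≤ i + j
  _⊞_ = +-mono-≤

  _⊠_ : ∀ {i j} → 0ℤ ≤ i → 0ℤ ≤ j → 0ℤ ≤ i * j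
  _⊠_ {+ m} {+ n} _ _ = subst (0ℤ ≤_) (pos-* m n) (+≤+ z≤n)

  absurd : ∀ {i} → 0ℤ ≤ i → i ≡ -1ℤ → ⊥
  absurd () refl

  by : ∀ {e i j} → 0ℤ ≤ e → e ≡ j - i → i ≤ j
  by p eq = 0≤i-j⇒j≤i (subst (0ℤ ≤_) eq p)

  ≰⇒suc≤ : ∀ {i j} → ¬ i ≤ j → 1ℤ + j ≤ i
  ≰⇒suc≤ = i<j⇒suc[i]≤j ∘ ≰⇒>

  +-exchange : ∀ i j k → i + (j + k) ≡ j + (i + k)
  +-exchange i j k = solve (i ∷ j ∷ k ∷ [])

  +-interchange : ∀ i j k l → i + j + (k + l) ≡ i + k + (j + l)
  +-interchange i j k l = solve (i ∷ j ∷ k ∷ l ∷ [])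

  double-step : ∀ i j → 0ℤ + i + (i + (j + j)) ≡ i + j + (i + j)
  double-step i j = solve (i ∷ j ∷ [])

  module _ (τ : ℤ) where

    -- For `t ≥ 4` and `m ≥ 3`, the bound `2t + m(5 - t)` falls as `t` grows and is `m + 8 = n + 4`
    -- at `t = 4`, one short of the `n + 5` that four degrees of at least `τ` give.
    heavy-4-set-light-outside : ∀ t m C → + 4 ≤ t → + 7 ≤ + 4 + m → + 4 + m + + 5 ≤ + 4 * τ → + 4 * τ ≤ t + t + C →
               C ≤ m * (+ 5 - t) → ⊥
    heavy-4-set-light-outside t m C p₁ p₂ p₃ p₄ p₅ =
      absurd ((gap p₁ ⊠ gap p₂) ⊞ gap p₁ ⊞ gap p₃ ⊞ gap p₄ ⊞ gap p₅) (solve (t ∷ m ∷ C ∷ τ ∷ []))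

    -- Adding the degree of the fifth vertex to the other four gives `5τ ≤ 2(t + u) + m(7 - t - u)`.
    -- As `t + u ≥ 6` and `m ≥ 2`, the right side is at most `12 + m = n + 7`, whereas `4τ ≥ n + 5`
    -- and `τ ≥ 3` give `n + 8`.
    heavy-4-set-low-degree : + 3 ≤ τ → ∀ t m u C s → + 6 - t ≤ u → + 7 ≤ + 5 + m → + 5 + m + + 5 ≤ + 4 * τ →
               + 4 * τ ≤ t + t + (u + C) → τ ≤ u + s → s + C ≤ m * (+ 7 - t - u) → ⊥
    heavy-4-set-low-degree p₀ t m u C s p₁ p₂ p₃ p₄ p₅ p₆ = absurd
      ((gap p₁ ⊠ gap p₂) ⊞ gap p₀ ⊞ gap p₃ ⊞ gap p₄ ⊞ gap p₅ ⊞ gap p₆) (solve (τ ∷ t ∷ m ∷ u ∷ C ∷ s ∷ []))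

    -- Since `t ≥ k + 1` and `m ≥ 4`, `2t + m(k + 1 - t)` is at most `2(k + 1)`, whereas the degrees
    -- add up to at least `3(k + 1)`.
    heavy-small-set : + 3 ≤ τ → ∀ k t m C → 0ℤ ≤ k → k ≤ + 2 → + 1 + k ≤ t → + 7 ≤ + 1 + k + m →
                  (+ 1 + k) * τ ≤ t + t + C → C ≤ m * (+ 1 + k - t) → ⊥
    heavy-small-set p₀ k t m C p₁ p₂ p₃ p₄ p₅ p₆ = absurd
      ((gap p₃ ⊠ (gap p₄ ⊞ gap p₂ ⊞ +≤+ {0} {2} z≤n)) ⊞ (p₁ ⊠ gap p₀) ⊞ gap p₀ ⊞ p₁ ⊞ gap p₅ ⊞ gap p₆)
      (solve (k ∷ t ∷ m ∷ C ∷ τ ∷ []))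

    -- The two discarding steps give `ζ ≥ R + 2τ - 2L - 4`; with `R ≥ τ + L` this yields
    -- `R + L + ζ ≥ 4τ + L - 4 ≥ n + 1`.
    clique-overflow : ∀ n R R₁ R₂ L d₁ d₂ z₁ z₂ ζ ζ₁ ζ₂ → n + + 5 ≤ + 4 * τ → 0ℤ ≤ L → τ + L ≤ R →
      R ≤ d₁ + 1ℤ + R₁ → R₁ ≤ d₂ + 1ℤ + R₂ → R₂ ≤ ζ₂ → z₁ + ζ₁ ≤ ζ → z₂ + ζ₂ ≤ ζ₁ →
      τ + d₁ ≤ z₁ + L + 1ℤ → τ + d₂ ≤ z₂ + L + 1ℤ → R + L + ζ ≤ n → ⊥
    clique-overflow n R R₁ R₂ L d₁ d₂ z₁ z₂ ζ ζ₁ ζ₂ p₀ p₁ p₂ p₃ p₄ p₅ p₆ p₇ p₈ p₉ p₁₀ = absurd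
      (gap p₀ ⊞ p₁ ⊞ gap p₂ ⊞ gap p₂ ⊞ gap p₃ ⊞ gap p₄ ⊞ gap p₅ ⊞ gap p₆ ⊞ gap p₇ ⊞ gap p₈ ⊞ gap p₉ ⊞ gap p₁₀)
      (solve (n ∷ R ∷ R₁ ∷ R₂ ∷ L ∷ d₁ ∷ d₂ ∷ z₁ ∷ z₂ ∷ ζ ∷ ζ₁ ∷ ζ₂ ∷ τ ∷ []))

    -- `L ≤ τ - 2` makes `z` at least `d + 1`, which covers everything discarded in one greedy step.
    hall-step : ∀ R R′ L d z ζ ζ′ → L ≤ τ - + 2 → R ≤ d + 1ℤ + R′ → R′ ≤ ζ′ → z + ζ′ ≤ ζ → τ + d ≤ z + L + 1ℤ → R ≤ ζ
    hall-step R R′ L d z ζ ζ′ p₁ p₂ p₃ p₄ p₅ =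
      by (gap p₁ ⊞ gap p₂ ⊞ gap p₃ ⊞ gap p₄ ⊞ gap p₅) (solve (R ∷ R′ ∷ L ∷ d ∷ z ∷ ζ ∷ ζ′ ∷ τ ∷ []))

    disjoint-neighbourhoods-overflow : ∀ n d d′ δ δ′ → n + + 5 ≤ + 4 * τ → τ - 1ℤ ≤ d → τ - 1ℤ ≤ d′ → τ + d ≤ δ → τ + d′ ≤ δ′ → δ + δ′ ≤ n → ⊥
    disjoint-neighbourhoods-overflow n d d′ δ δ′ p₁ p₂ p₃ p₄ p₅ p₆ = absurd
      (gap p₁ ⊞ gap p₂ ⊞ gap p₃ ⊞ gap p₄ ⊞ gap p₅ ⊞ gap p₆ ⊞ +≤+ {0} {2} z≤n) (solve (n ∷ d ∷ d′ ∷ δ ∷ δ′ ∷ τ ∷ []))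

    large-from : ∀ d d′ δ → 0ℤ ≤ d → τ + d ≤ δ → δ ≤ d′ + 1ℤ → τ - 1ℤ ≤ d′
    large-from d d′ δ p₁ p₂ p₃ = by (p₁ ⊞ gap p₂ ⊞ gap p₃) (solve (d ∷ d′ ∷ δ ∷ τ ∷ []))

    small-from : ∀ d → 1ℤ + d ≤ τ - 1ℤ → d ≤ τ - + 2
    small-from d p = by (gap p) (solve (d ∷ τ ∷ []))

  pred₆ : ∀ t i → 1ℤ + i ≤ + 6 - t → i ≤ + 5 - t
  pred₆ t i p = by (gap p) (solve (t ∷ i ∷ []))

  isolate : ∀ i j k l → i + j + (k + l) ≤ + 7 → i + j ≤ + 7 - l - k
  isolate i j k l p = by (gap p) (solve (i ∷ j ∷ k ∷ l ∷ []))

  transpose : ∀ i t k → i + t ≤ k → i ≤ k - t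
  transpose i t k p = by (gap p) (solve (i ∷ t ∷ k ∷ []))

  drop-zeros : ∀ i → i + 0ℤ + (0ℤ + 0ℤ) ≤ + 1 → i ≤ + 1
  drop-zeros i p = by (gap p) (solve (i ∷ []))

  diagonal : ∀ i j → 0ℤ ≤ i → i + + 2 + (+ 2 + (j + 0ℤ + 0ℤ)) ≤ + 3 → j ≤ -1ℤ
  diagonal i j p q = by (p ⊞ gap q) (solve (i ∷ j ∷ []))

  pred₁ : ∀ i → 1ℤ + i ≤ 1ℤ → i ≤ 0ℤ
  pred₁ i p = by (gap p) (solve (i ∷ []))

open import Data.Bool as Bool using (Bool; true; false; _∧_; if_then_else_)
open import Data.Empty using (⊥; ⊥-elim)
open import Data.Fin using (Fin; zero; suc; _<?_) renaming (_<_ to _<ᶠ_; _≟_ to _≟ᶠ_)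
import Data.Fin.Properties as Fin
open import Data.Fin.Subset using (Subset; ∣_∣)
open import Data.Integer as ℤ using (ℤ; +_; 0ℤ; 1ℤ; -1ℤ; +≤+)
import Data.Integer.Properties as ℤ
open import Data.Integer.Tactic.RingSolver using () renaming (solve-∀ to solve-∀-ℤ)
open import Data.List using (List; []; _∷_; _++_; length; map; filter; concatMap; concat; allFin; tabulate)
import Data.List.Membership.DecPropositional as DecMembership
open import Data.List.Membership.Propositional using (_∈_; find)
open import Data.List.Membership.Propositional.Properties using (∈-∃++; ∈-filter⁻; ∈-filter⁺; ∈-++⁻; ∈-++⁺ˡ; ∈-++⁺ʳ; ∈-allFin)
open import Data.List.Properties using (length-++; length-map; length-filter; length-tabulate; map-++; map-∘; map-cong-local; filter-reject; filter-all; filter-none; filter-++; ++-identityʳ)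
open import Data.List.Relation.Binary.Permutation.Propositional as ↭ using (_↭_; ↭-sym; ↭-trans; ↭-reflexive; ↭⇒↭ₛ)
open import Data.List.Relation.Binary.Permutation.Propositional.Properties using (shift; shifts; ↭-length; ∈-resp-↭; ++⁺; ++⁺ˡ; map⁺; filter-↭)
import Data.List.Relation.Binary.Permutation.Setoid.Properties as ↭ₛ
open import Data.List.Relation.Unary.All as All using (All; []; _∷_)
open import Data.List.Relation.Unary.AllPairs as AllPairs using (AllPairs; []; _∷_)
open import Data.List.Relation.Unary.AllPairs.Properties using (tabulate⁺-<)
open import Data.List.Relation.Unary.Any as Any using (Any; here; there; any?)
open import Data.List.Relation.Unary.Unique.Propositional using (Unique)
open import Data.List.Relation.Unary.Unique.Propositional.Properties using (allFin⁺)
open import Data.Nat as ℕ using (ℕ; zero; suc; z≤n; s≤s)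
open import Data.Nat.Combinatorics using (_C_)
open import Data.Nat.ListAction using (sum; product)
open import Data.Nat.ListAction.Properties using (sum-++; sum-↭; product-++; product-↭)
import Data.Nat.Properties as ℕ
open import Data.Product using (_×_; _,_; proj₁; ∃; ∃₂; ∃-syntax)
open import Data.Sum using (_⊎_; inj₁; inj₂)
open import Data.Vec using ([]; _∷_; lookup)
import Data.Vec as Vec
open import Data.Vec.Properties using (lookup∘tabulate)
open import Function using (_∘_; id)
open import Relation.Binary using (DecidableEquality; tri<; tri≈; tri>)
open import Relation.Binary.PropositionalEquality using (_≡_; _≢_; refl; sym; trans; cong; cong₂; subst; setoid; module ≡-Reasoning)
open import Relation.Nullary using (¬_; Dec; yes; no; contradiction)
open import Relation.Nullary.Decidable using (does; dec-true; dec-false; ¬?; _×-dec_; _⊎-dec_)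
open import Relation.Unary using (Decidable)

-- Permutations and duplicate-free lists

private variable
  A B : Set

∈-split : ∀ {x : A} {xs} → x ∈ xs → ∃ λ ys → xs ↭ x ∷ ys
∈-split x∈xs with ys , zs , refl ← ∈-∃++ x∈xs = ys ++ zs , shift _ ys zs

-- Vertex sets are handled through splittings `V ↭ X ++ Y`, which keep the complement `Y` at hand;
-- this produces them from explicit lists.
⊆-split : ∀ (xs : List A) {zs} → Unique xs → (∀ {x} → x ∈ xs → x ∈ zs) → ∃ λ ys → zs ↭ xs ++ ys
⊆-split []       {zs} _         _  = zs , ↭.refl
⊆-split (x ∷ xs) {zs} (x∉ ∷ u) ⊆zs with ys , p ← ⊆-split xs u (⊆zs ∘ there)
  with ∈-++⁻ xs (∈-resp-↭ p (⊆zs (here refl)))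
... | inj₁ x∈xs = contradiction refl (All.lookup x∉ x∈xs)
... | inj₂ x∈ys with ys′ , q ← ∈-split x∈ys = ys′ , ↭-trans p (↭-trans (++⁺ˡ xs q) (shift x xs ys′))

unique⇒allPairs : ∀ {R : A → A → Set} xs → Unique xs → (∀ {x y} → x ∈ xs → y ∈ xs → x ≢ y → R x y) → AllPairs R xs
unique⇒allPairs []       []       _ = []
unique⇒allPairs (x ∷ xs) (x∉ ∷ u) r =
  All.tabulate (λ y∈ → r (here refl) (there y∈) (All.lookup x∉ y∈)) ∷
  unique⇒allPairs xs u (λ x∈ y∈ → r (there x∈) (there y∈))

Unique-resp-↭ : ∀ {xs ys : List A} → xs ↭ ys → Unique xs → Unique ys
Unique-resp-↭ p = ↭ₛ.Unique-resp-↭ (setoid _) (↭⇒↭ₛ p)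

unique-++ˡ : ∀ (xs : List A) {ys} → Unique (xs ++ ys) → Unique xs
unique-++ˡ []       _        = []
unique-++ˡ (x ∷ xs) (x∉ ∷ u) = All.tabulate (λ y∈ → All.lookup x∉ (∈-++⁺ˡ y∈)) ∷ unique-++ˡ xs u

unique-disjoint : ∀ (xs : List A) {ys x} → Unique (xs ++ ys) → x ∈ xs → x ∈ ys → ⊥
unique-disjoint (x ∷ xs) (x∉ ∷ _) (here refl)  x∈ys = All.lookup x∉ (∈-++⁺ʳ xs x∈ys) refl
unique-disjoint (x ∷ xs) (_ ∷ u)  (there x∈xs) x∈ys = unique-disjoint xs u x∈xs x∈ys

-- Integer sums over lists

module Integers where

  open import Data.Integer renaming (_≟_ to _≟′_) hiding (suc)
  open import Data.Integer.Properties using (≤-refl; ≤-reflexive; ≤-trans; ≤∧≢⇒<; i<j⇒suc[i]≤j; +-mono-≤; +-monoʳ-≤; +-assoc; +-identityˡ; suc-*)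
  open IntegerArithmetic

  ∑ : List A → (A → ℤ) → ℤ
  ∑ []       f = 0ℤ
  ∑ (x ∷ xs) f = f x + ∑ xs f

  ∑-++ : ∀ (xs ys : List A) f → ∑ (xs ++ ys) f ≡ ∑ xs f + ∑ ys f
  ∑-++ []       ys f = sym (+-identityˡ _)
  ∑-++ (x ∷ xs) ys f = trans (cong (_+_ (f x)) (∑-++ xs ys f)) (sym (+-assoc (f x) (∑ xs f) (∑ ys f)))

  ∑-↭ : ∀ (f : A → ℤ) {xs ys} → xs ↭ ys → ∑ xs f ≡ ∑ ys f
  ∑-↭ f ↭.refl                   = refl
  ∑-↭ f (↭.prep x p)             = cong (_+_ (f x)) (∑-↭ f p)
  ∑-↭ f (↭.swap {ys = ys} x y p) =
    trans (cong (λ s → f x + (f y + s)) (∑-↭ f p)) (+-exchange (f x) (f y) (∑ ys f))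
  ∑-↭ f (↭.trans p q)            = trans (∑-↭ f p) (∑-↭ f q)

  ∑-mono : ∀ {f g : A → ℤ} xs → (∀ {x} → x ∈ xs → f x ≤ g x) → ∑ xs f ≤ ∑ xs g
  ∑-mono []       f≤g = ≤-refl
  ∑-mono (x ∷ xs) f≤g = +-mono-≤ (f≤g (here refl)) (∑-mono xs (f≤g ∘ there))

  ∑-cong : ∀ {f g : A → ℤ} xs → (∀ x → f x ≡ g x) → ∑ xs f ≡ ∑ xs g
  ∑-cong []       f≡g = refl
  ∑-cong (x ∷ xs) f≡g = cong₂ _+_ (f≡g x) (∑-cong xs f≡g)

  ∑-+ : ∀ (xs : List A) (f g : A → ℤ) → ∑ xs (λ x → f x + g x) ≡ ∑ xs f + ∑ xs g
  ∑-+ []       f g = refl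
  ∑-+ (x ∷ xs) f g =
    trans (cong (_+_ (f x + g x)) (∑-+ xs f g)) (+-interchange (f x) (g x) (∑ xs f) (∑ xs g))

  ∑-const : ∀ (xs : List A) k → ∑ xs (λ _ → k) ≡ + length xs * k
  ∑-const []       k = refl
  ∑-const (x ∷ xs) k = trans (cong (_+_ k) (∑-const xs k)) (sym (suc-* (+ length xs) k))

  ∑-length : ∀ (xs : List A) → ∑ xs (λ _ → 1ℤ) ≡ + length xs
  ∑-length []       = refl
  ∑-length (x ∷ xs) = cong (_+_ 1ℤ) (∑-length xs)

  ∑-swap : ∀ (xs : List A) (ys : List B) (F : A → B → ℤ) →
           ∑ xs (λ x → ∑ ys (F x)) ≡ ∑ ys (λ y → ∑ xs (λ x → F x y))
  ∑-swap []       ys F = sym (zeros ys)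
    where
    zeros : ∀ (ys : List B) → ∑ ys (λ _ → 0ℤ) ≡ 0ℤ
    zeros []       = refl
    zeros (y ∷ ys) = trans (+-identityˡ _) (zeros ys)
  ∑-swap (x ∷ xs) ys F =
    trans (cong (_+_ (∑ ys (F x))) (∑-swap xs ys F)) (sym (∑-+ ys (F x) (λ y → ∑ xs (λ x → F x y))))

  ∑-nonneg : ∀ {f : A → ℤ} xs → (∀ x → 0ℤ ≤ f x) → 0ℤ ≤ ∑ xs f
  ∑-nonneg []       p = ≤-refl
  ∑-nonneg (x ∷ xs) p = p x ⊞ ∑-nonneg xs p

  ind : ∀ {P : Set} → Dec P → ℤ
  ind (yes _) = 1ℤ
  ind (no _)  = 0ℤ

  ind-nonneg : ∀ {P : Set} (d : Dec P) → 0ℤ ≤ ind d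
  ind-nonneg (yes _) = +≤+ z≤n
  ind-nonneg (no _)  = +≤+ z≤n

  ∑-filter : ∀ {P : A → Set} (P? : Decidable P) xs → + length (filter P? xs) ≡ ∑ xs (ind ∘ P?)
  ∑-filter P? []       = refl
  ∑-filter P? (x ∷ xs) with P? x
  ... | yes _ = cong (_+_ 1ℤ) (∑-filter P? xs)
  ... | no _  = trans (∑-filter P? xs) (sym (+-identityˡ _))

  length-split : ∀ {P : A → Set} (P? : Decidable P) xs →
                 + length xs ≡ ∑ xs (ind ∘ P?) + + length (filter (¬? ∘ P?) xs)
  length-split P? []       = refl
  length-split P? (x ∷ xs) with P? x
  ... | yes _ = trans (cong (_+_ 1ℤ) (length-split P? xs)) (sym (+-assoc 1ℤ (∑ xs (ind ∘ P?)) _))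
  ... | no _  = trans (cong (_+_ 1ℤ) (length-split P? xs))
                    (trans (+-exchange 1ℤ (∑ xs (ind ∘ P?)) _)
                      (cong (λ i → i + + suc (length (filter (¬? ∘ P?) xs))) (sym (+-identityˡ (∑ xs (ind ∘ P?))))))

  -- Inclusion of lists as multisets, expressed by its effect on counting so that it composes by
  -- transitivity of `≤`.
  _⊑_ : List A → List A → Set
  xs ⊑ ys = ∀ f → (∀ x → 0ℤ ≤ f x) → ∑ xs f ≤ ∑ ys f

  filter-⊑ : ∀ {P : A → Set} (P? : Decidable P) xs → filter P? xs ⊑ xs
  filter-⊑ P? []       f p = ≤-refl
  filter-⊑ P? (x ∷ xs) f p with P? x
  ... | yes _ = +-monoʳ-≤ (f x) (filter-⊑ P? xs f p)
  ... | no _  = subst (_≤ f x + ∑ xs f) (+-identityˡ _) (+-mono-≤ (p x) (filter-⊑ P? xs f p))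

  tail-⊑ : ∀ (x : A) xs → xs ⊑ (x ∷ xs)
  tail-⊑ x xs f p = subst (_≤ f x + ∑ xs f) (+-identityˡ _) (+-mono-≤ (p x) ≤-refl)

  ∑-ind-≟≤1 : (_≟_ : DecidableEquality A) → ∀ {xs} → Unique xs → ∀ y → ∑ xs (λ x → ind (x ≟ y)) ≤ 1ℤ
  ∑-ind-≟≤1 _≟_ []       y = +≤+ z≤n
  ∑-ind-≟≤1 _≟_ {x ∷ xs} (x∉ ∷ u) y with x ≟ y
  ... | yes refl = ≤-reflexive (cong (_+_ 1ℤ) (none xs x∉))
    where
    none : ∀ zs → All (λ z → x ≢ z) zs → ∑ zs (λ z → ind (z ≟ x)) ≡ 0ℤ
    none []       []       = refl
    none (z ∷ zs) (x≢z ∷ p) with z ≟ x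
    ... | yes z≡x = contradiction (sym z≡x) x≢z
    ... | no _    = trans (+-identityˡ _) (none zs p)
  ... | no _     = subst (_≤ 1ℤ) (sym (+-identityˡ _)) (∑-ind-≟≤1 _≟_ u y)

  -- Multigraphs in which every degree is large

  module Structure {A : Set} (_≟_ : DecidableEquality A) (c : A → A → ℤ)
    (c-sym : ∀ x y → c x y ≡ c y x) (c-refl : ∀ x → c x x ≡ 0ℤ) where

    pairSum : List A → ℤ
    pairSum []       = 0ℤ
    pairSum (x ∷ xs) = ∑ xs (c x) + pairSum xs

    ∑∑≡2pairSum : ∀ xs → ∑ xs (λ x → ∑ xs (c x)) ≡ pairSum xs + pairSum xs
    ∑∑≡2pairSum []       = refl
    ∑∑≡2pairSum (x ∷ xs) = begin
      c x x + ∑ xs (c x) + ∑ xs (λ y → c y x + ∑ xs (c y))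
        ≡⟨ cong₂ (λ i j → i + ∑ xs (c x) + j) (c-refl x) (∑-+ xs (λ y → c y x) (λ y → ∑ xs (c y))) ⟩
      0ℤ + ∑ xs (c x) + (∑ xs (λ y → c y x) + ∑ xs (λ y → ∑ xs (c y)))
        ≡⟨ cong₂ (λ i j → 0ℤ + ∑ xs (c x) + (i + j)) (∑-cong xs (λ y → c-sym y x)) (∑∑≡2pairSum xs) ⟩
      0ℤ + ∑ xs (c x) + (∑ xs (c x) + (pairSum xs + pairSum xs))
        ≡⟨ double-step (∑ xs (c x)) (pairSum xs) ⟩
      ∑ xs (c x) + pairSum xs + (∑ xs (c x) + pairSum xs) ∎
      where open ≡-Reasoning

    module Configuration (V : List A) (V-unique : Unique V) (τ : ℤ) (3≤τ : + 3 ≤ τ) (7≤n : + 7 ≤ + length V)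
      (n+5≤4τ : + length V + + 5 ≤ + 4 * τ)
      (6-sets : ∀ X Y → V ↭ X ++ Y → length X ≡ 6 → pairSum X ≤ + 7)
      (min-degree : ∀ {x} → x ∈ V → τ ≤ ∑ V (c x)) where

      -- Summing the degrees over `X` counts the pairs inside `X` twice and those leaving `X` once;
      -- the latter are regrouped by their outer endpoint.
      degree-sum : ∀ X Y {k} → V ↭ X ++ Y → length X ≡ k →
                   + k * τ ≤ pairSum X + pairSum X + ∑ Y (λ u → ∑ X (c u))
      degree-sum X Y V↭ refl = subst (+ length X * τ ≤_) eq (subst (_≤ ∑ X (λ x → ∑ V (c x))) (∑-const X τ)
        (∑-mono X (λ x∈X → min-degree (∈-resp-↭ (↭-sym V↭) (∈-++⁺ˡ x∈X)))))
        where
        open ≡-Reasoning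
        eq : ∑ X (λ x → ∑ V (c x)) ≡ pairSum X + pairSum X + ∑ Y (λ u → ∑ X (c u))
        eq = begin
          ∑ X (λ x → ∑ V (c x))
            ≡⟨ ∑-cong X (λ x → trans (∑-↭ (c x) V↭) (∑-++ X Y (c x))) ⟩
          ∑ X (λ x → ∑ X (c x) + ∑ Y (c x))
            ≡⟨ ∑-+ X (λ x → ∑ X (c x)) (λ x → ∑ Y (c x)) ⟩
          ∑ X (λ x → ∑ X (c x)) + ∑ X (λ x → ∑ Y (c x))
            ≡⟨ cong₂ _+_ (∑∑≡2pairSum X) (∑-swap X Y c) ⟩
          pairSum X + pairSum X + ∑ Y (λ u → ∑ X (λ x → c x u))
            ≡⟨ cong (_+_ (pairSum X + pairSum X)) (∑-cong Y (λ u → ∑-cong X (λ x → c-sym x u))) ⟩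
          pairSum X + pairSum X + ∑ Y (λ u → ∑ X (c u)) ∎

      length-V : ∀ X Y → V ↭ X ++ Y → + length V ≡ + length X + + length Y
      length-V X Y V↭ = cong +_ (trans (↭-length V↭) (length-++ X))

      move : ∀ {X Y u Y′} → V ↭ X ++ Y → Y ↭ u ∷ Y′ → V ↭ (u ∷ X) ++ Y′
      move {X} {u = u} {Y′} p q = ↭-trans p (↭-trans (++⁺ˡ X q) (shift u X Y′))

      4-sets : ∀ X Y → V ↭ X ++ Y → length X ≡ 4 → pairSum X ≤ + 3
      4-sets X Y V↭ |X|≡4 with pairSum X ≤? + 3
      ... | yes p = p
      ... | no t≰3 with any? (λ u → (+ 6 - pairSum X) ≤? ∑ X (c u)) Y
      ...   | no none = ⊥-elim (heavy-4-set-light-outside τ (pairSum X) (+ length Y) (∑ Y (λ u → ∑ X (c u))) (≰⇒suc≤ t≰3)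
          (subst (+ 7 ≤_) n≡ 7≤n) (subst (λ n → n + + 5 ≤ + 4 * τ) n≡ n+5≤4τ)
          (degree-sum X Y V↭ |X|≡4)
          (subst (∑ Y (λ u → ∑ X (c u)) ≤_) (∑-const Y _) (∑-mono Y (λ {u} u∈Y →
            pred₆ (pairSum X) (∑ X (c u)) (≰⇒suc≤ (λ q → none (Any.map (λ { refl → q }) u∈Y)))))))
        where
        n≡ : + length V ≡ + 4 + + length Y
        n≡ = subst (λ k → + length V ≡ + k + + length Y) |X|≡4 (length-V X Y V↭)
      -- Now `u ∷ X` spans at least 6, so by the 6-set bound a further vertex sends at most
      -- `7 - pairSum X - T u ≤ 1` to these five vertices, too little for their degrees to add up to
      -- `5τ`.
      ...   | yes some with u , u∈Y , 6-t≤u ← find some with Y′ , Y↭ ← ∈-split u∈Y =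
        ⊥-elim (heavy-4-set-low-degree τ 3≤τ (pairSum X) (+ length Y′) (∑ X (c u)) (∑ Y′ T) (∑ Y′ (c u)) 6-t≤u
          (subst (+ 7 ≤_) n≡ 7≤n) (subst (λ n → n + + 5 ≤ + 4 * τ) n≡ n+5≤4τ)
          (subst (λ i → + 4 * τ ≤ pairSum X + pairSum X + i) (∑-↭ T Y↭)
            (degree-sum X Y V↭ |X|≡4))
          (subst (τ ≤_) degree-u (min-degree (∈-resp-↭ (↭-sym V↭′) (here refl))))
          (≤-trans (≤-reflexive (sym (∑-+ Y′ (c u) T))) (≤-trans (∑-mono Y′ pair) (≤-reflexive (∑-const Y′ _)))))
        where
        T : A → ℤ
        T v = ∑ X (c v)
        V↭′ : V ↭ (u ∷ X) ++ Y′
        V↭′ = move V↭ Y↭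
        n≡ : + length V ≡ + 5 + + length Y′
        n≡ = subst (λ k → + length V ≡ + suc k + + length Y′) |X|≡4 (length-V (u ∷ X) Y′ V↭′)
        degree-u : ∑ V (c u) ≡ ∑ X (c u) + ∑ Y′ (c u)
        degree-u = trans (∑-↭ (c u) V↭′) (trans (cong₂ _+_ (c-refl u) (∑-++ X Y′ (c u))) (+-identityˡ _))
        pair : ∀ {v} → v ∈ Y′ → c u v + T v ≤ + 7 - pairSum X - T u
        pair {v} v∈Y′ with Y″ , Y′↭ ← ∈-split v∈Y′ =
          subst (λ i → i + T v ≤ + 7 - pairSum X - T u) (c-sym v u)
            (isolate (c v u) (T v) (T u) (pairSum X)
              (6-sets (v ∷ u ∷ X) Y″ (move V↭′ Y′↭) (cong (λ k → suc (suc k)) |X|≡4)))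

      SetsOfSize1+_ : ℕ → Set
      SetsOfSize1+ k = ∀ X Y → V ↭ X ++ Y → length X ≡ suc k → pairSum X ≤ + k

      -- If X of size suc k spans more than k, then no outside vertex sends positive excess to X, so
      -- the vertices of X cannot all have large degree.
      descend : ∀ k → k ℕ.≤ 2 → SetsOfSize1+ (suc k) → SetsOfSize1+ k
      descend k k≤2 larger X Y V↭ |X| with pairSum X ≤? + k
      ... | yes p = p
      ... | no t≰k = ⊥-elim (heavy-small-set τ 3≤τ (+ k) (pairSum X) (+ length Y) (∑ Y (λ u → ∑ X (c u)))
          (+≤+ z≤n) (+≤+ k≤2) (≰⇒suc≤ t≰k) (subst (+ 7 ≤_) n≡ 7≤n)
          (degree-sum X Y V↭ |X|)
          (subst (∑ Y (λ u → ∑ X (c u)) ≤_) (∑-const Y _) (∑-mono Y outside)))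
        where
        n≡ : + length V ≡ + suc k + + length Y
        n≡ = subst (λ k → + length V ≡ + k + + length Y) |X| (length-V X Y V↭)
        outside : ∀ {u} → u ∈ Y → ∑ X (c u) ≤ + suc k - pairSum X
        outside {u} u∈Y with Y′ , Y↭ ← ∈-split u∈Y =
          transpose (∑ X (c u)) (pairSum X) (+ suc k) (larger (u ∷ X) Y′ (move V↭ Y↭) (cong suc |X|))

      3-sets : SetsOfSize1+ 2
      3-sets = descend 2 ℕ.≤-refl 4-sets

      2-sets : SetsOfSize1+ 1
      2-sets = descend 1 (s≤s z≤n) 3-sets

      c≤1 : ∀ {x y} → x ∈ V → y ∈ V → c x y ≤ 1ℤ
      c≤1 {x} {y} x∈V y∈V with x ≟ y
      ... | yes refl = subst (_≤ 1ℤ) (sym (c-refl x)) (+≤+ z≤n)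
      ... | no x≢y with Y , V↭ ← ⊆-split (x ∷ y ∷ []) ((x≢y ∷ []) ∷ [] ∷ []) (λ { (here refl) → x∈V ; (there (here refl)) → y∈V }) =
        drop-zeros (c x y) (2-sets (x ∷ y ∷ []) Y V↭ refl)

      H L : A → A → Set
      H x y = c x y ≡ 1ℤ
      L x y = c x y ≤ -1ℤ

      H? : ∀ x y → Dec (H x y)
      H? x y = c x y ≟′ 1ℤ

      L? : ∀ x y → Dec (L x y)
      L? x y = c x y ≤? -1ℤ

      H-sym : ∀ {x y} → H x y → H y x
      H-sym {x} {y} = trans (c-sym y x)

      H⇒≢ : ∀ {x y} → H x y → x ≢ y
      H⇒≢ {x} h refl with () ← trans (sym (c-refl x)) h

      H⇒¬L : ∀ {x y} → H x y → ¬ L x y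
      H⇒¬L h l with () ← subst (_≤ -1ℤ) h l

      triangle-free : ∀ {x y z} → x ∈ V → y ∈ V → z ∈ V → H x y → H x z → H y z → ⊥
      triangle-free {x} {y} {z} x∈V y∈V z∈V xy xz yz
        with Y , V↭ ← ⊆-split (x ∷ y ∷ z ∷ []) ((H⇒≢ xy ∷ H⇒≢ xz ∷ []) ∷ (H⇒≢ yz ∷ []) ∷ [] ∷ [])
                        (λ { (here refl) → x∈V ; (there (here refl)) → y∈V ; (there (there (here refl))) → z∈V })
        with p ← 3-sets (x ∷ y ∷ z ∷ []) Y V↭ refl rewrite xy | xz | yz with p
      ... | +≤+ (s≤s (s≤s ()))

      -- The four edges of the cycle already contribute 4 and `4-sets` allows 3, so the two
      -- diagonals together have excess at most -1.
      4-cycle : ∀ {x z r s} → x ∈ V → z ∈ V → r ∈ V → s ∈ V → x ≢ z → r ≢ s →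
                H x r → H x s → H z r → H z s → ¬ L x z → L r s
      4-cycle {x} {z} {r} {s} x∈V z∈V r∈V s∈V x≢z r≢s xr xs zr zs ¬xz
        with Y , V↭ ← ⊆-split (x ∷ z ∷ r ∷ s ∷ [])
                        ((x≢z ∷ H⇒≢ xr ∷ H⇒≢ xs ∷ []) ∷ (H⇒≢ zr ∷ H⇒≢ zs ∷ []) ∷ (r≢s ∷ []) ∷ [] ∷ [])
                        (λ { (here refl) → x∈V ; (there (here refl)) → z∈V ; (there (there (here refl))) → r∈V
                           ; (there (there (there (here refl)))) → s∈V })
        with p ← 4-sets (x ∷ z ∷ r ∷ s ∷ []) Y V↭ refl rewrite xr | xs | zr | zs =
        diagonal (c x z) (c r s) (≰⇒suc≤ ¬xz) p

      h l : A → A → ℤ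
      h x y = ind (H? x y)
      l x y = ind (L? x y)

      dH dL : A → ℤ
      dH x = ∑ V (h x)
      dL x = ∑ V (l x)

      dL-nonneg : ∀ x → 0ℤ ≤ dL x
      dL-nonneg x = ∑-nonneg V (λ y → ind-nonneg (L? x y))

      c≤0 : ∀ {x y} → x ∈ V → y ∈ V → ¬ H x y → c x y ≤ 0ℤ
      c≤0 {x} {y} x∈V y∈V ¬xy = pred₁ (c x y) (i<j⇒suc[i]≤j (≤∧≢⇒< (c≤1 x∈V y∈V) ¬xy))

      -- Pointwise `c + l ≤ h`, since the excess is at most 1, at most 0 off `H`, and at most -1 on
      -- `L`. Every `L`-neighbour thus has to be offset by a further `H`-neighbour.
      clean-degree : ∀ {x} → x ∈ V → τ + dL x ≤ dH x
      clean-degree {x} x∈V = ≤-trans (+-mono-≤ (min-degree x∈V) ≤-refl)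
        (subst (_≤ dH x) (∑-+ V (c x) (l x)) (∑-mono V pointwise))
        where
        pointwise : ∀ {y} → y ∈ V → c x y + l x y ≤ h x y
        pointwise {y} y∈V with H? x y | L? x y
        ... | yes xy | yes xy′ = ⊥-elim (H⇒¬L xy xy′)
        ... | yes xy | no _    = subst (λ i → i + 0ℤ ≤ 1ℤ) (sym xy) ≤-refl
        ... | no _   | yes xy  = +-mono-≤ xy (≤-refl {1ℤ})
        ... | no ¬xy | no _    = +-mono-≤ (c≤0 x∈V y∈V ¬xy) (≤-refl {0ℤ})

      -- The closed `L`-neighbourhood: `r` itself is included because `c r r` is 0, so that
      -- discarding `L[ r ]` also discards `r`.
      L[_] : A → A → Set
      L[ r ] u = L r u ⊎ u ≡ r

      L[_]? : ∀ r u → Dec (L[ r ] u)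
      L[ r ]? u = L? r u ⊎-dec u ≟ r

      ∑-L[] : ∀ r → ∑ V (ind ∘ L[ r ]?) ≤ dL r + 1ℤ
      ∑-L[] r = ≤-trans (∑-mono V (λ {u} _ → pointwise u))
        (≤-trans (≤-reflexive (∑-+ V (l r) (λ u → ind (u ≟ r)))) (+-monoʳ-≤ (dL r) (∑-ind-≟≤1 _≟_ V-unique r)))
        where
        pointwise : ∀ u → ind (L[ r ]? u) ≤ l r u + ind (u ≟ r)
        pointwise u with L? r u | u ≟ r
        ... | yes _ | yes _ = +≤+ (s≤s z≤n)
        ... | yes _ | no _  = ≤-refl
        ... | no _  | yes _ = ≤-refl
        ... | no _  | no _  = ≤-refl

      remove-L[] : ∀ r Rs → Rs ⊑ V → + length Rs ≤ dL r + 1ℤ + + length (filter (¬? ∘ L[ r ]?) Rs)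
      remove-L[] r Rs Rs⊑V = ≤-trans (≤-reflexive (length-split L[ r ]? Rs))
        (+-mono-≤ (≤-trans (Rs⊑V _ (λ u → ind-nonneg (L[ r ]? u))) (∑-L[] r)) ≤-refl)

      module Neighbourhood {y} (y∈V : y ∈ V) (small : dL y ≤ τ - + 2) where

        -- For `u` in `V` this means `u ≠ y` and `c y u` zero. In a 4-cycle through `y` and such a
        -- `u`, the diagonal in `L` must be the other one.
        Z : A → Set
        Z u = ¬ H y u × ¬ L y u × u ≢ y

        Z? : ∀ u → Dec (Z u)
        Z? u = ¬? (H? y u) ×-dec ¬? (L? y u) ×-dec ¬? (u ≟ y)

        Reached : List A → A → Set
        Reached Rs u = Z u × Any (λ r → H r u) Rs

        reached? : ∀ Rs u → Dec (Reached Rs u)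
        reached? Rs u = Z? u ×-dec any? (λ r → H? r u) Rs

        ζ : List A → ℤ
        ζ Rs = ∑ V (ind ∘ reached? Rs)

        N : A → Set
        N r = r ∈ V × H y r

        -- An `H`-neighbour of `r` is no `H`-neighbour of `y`, by `triangle-free`, so it lies in
        -- `Z`, is an `L`-neighbour of `y`, or is `y`; now apply `clean-degree` to `r`.
        ζ-single : ∀ {r} → N r → τ + dL r ≤ ζ (r ∷ []) + dL y + 1ℤ
        ζ-single {r} (r∈V , yr) = ≤-trans (clean-degree r∈V) (≤-trans (∑-mono V pointwise)
          (≤-trans (≤-reflexive (trans (∑-+ V _ _) (cong (λ i → i + _) (∑-+ V _ (l y)))))
            (+-monoʳ-≤ (ζ (r ∷ []) + dL y) (∑-ind-≟≤1 _≟_ V-unique y))))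
          where
          pointwise : ∀ {u} → u ∈ V → h r u ≤ ind (reached? (r ∷ []) u) + l y u + ind (u ≟ y)
          pointwise {u} u∈V = cases (H? r u) (reached? (r ∷ []) u) (L? y u) (u ≟ y)
            where
            cases : (a : Dec (H r u)) (b : Dec (Reached (r ∷ []) u)) (c : Dec (L y u)) (d : Dec (u ≡ y)) →
                    ind a ≤ ind b + ind c + ind d
            cases (no _)   b       c        d        = ind-nonneg b ⊞ ind-nonneg c ⊞ ind-nonneg d
            cases (yes _)  b       (yes _)  d        = +-mono-≤ (+-mono-≤ (ind-nonneg b) (≤-refl {1ℤ})) (ind-nonneg d)
            cases (yes _)  b       (no _)   (yes _)  = +-mono-≤ (+-mono-≤ (ind-nonneg b) (≤-refl {0ℤ})) (≤-refl {1ℤ})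
            cases (yes _)  (yes _) (no _)   (no _)   = ≤-refl
            cases (yes ru) (no ¬p) (no ¬yu) (no u≢y) =
              ⊥-elim (¬p (((λ yu → triangle-free y∈V r∈V u∈V yr yu ru) , ¬yu , u≢y) , here ru))

        -- A vertex of `Z` reached both from `r` and from some `s` in `Rs′` would close a 4-cycle
        -- with `y`, forcing `L r s`. Hence the two reached sets are disjoint.
        ζ-add : ∀ {r Rs} Rs′ → N r → r ∈ Rs → (∀ {s} → s ∈ Rs′ → s ∈ Rs × N s × ¬ L[ r ] s) →
                ζ (r ∷ []) + ζ Rs′ ≤ ζ Rs
        ζ-add {r} {Rs} Rs′ (r∈V , yr) r∈Rs Rs′⊆ =
          ≤-trans (≤-reflexive (sym (∑-+ V _ _))) (∑-mono V pointwise)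
          where
          pointwise : ∀ {u} → u ∈ V → ind (reached? (r ∷ []) u) + ind (reached? Rs′ u) ≤ ind (reached? Rs u)
          pointwise {u} u∈V = cases (reached? (r ∷ []) u) (reached? Rs′ u) (reached? Rs u)
            where
            cases : (a : Dec (Reached (r ∷ []) u)) (b : Dec (Reached Rs′ u)) (c : Dec (Reached Rs u)) →
                    ind a + ind b ≤ ind c
            cases (yes ((_ , ¬yu , u≢y) , here ru)) (yes (_ , some)) _
              with s , s∈Rs′ , su ← find some with _ , (s∈V , ys) , ¬L[r]s ← Rs′⊆ s∈Rs′ =
              ⊥-elim (¬L[r]s (inj₁ (4-cycle y∈V u∈V r∈V s∈V (u≢y ∘ sym) (λ { refl → ¬L[r]s (inj₂ refl) })
                yr ys (H-sym ru) (H-sym su) ¬yu)))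
            cases (yes _) (no _)  (yes _) = ≤-refl
            cases (no _)  (yes _) (yes _) = ≤-refl
            cases (no _)  (no _)  c       = ind-nonneg c
            cases (yes (z , here ru)) (no _) (no ¬p) = ⊥-elim (¬p (z , Any.map (λ { refl → ru }) r∈Rs))
            cases (no _) (yes (z , some)) (no ¬p) with s , s∈Rs′ , su ← find some =
              ⊥-elim (¬p (z , Any.map (λ { refl → su }) (proj₁ (Rs′⊆ s∈Rs′))))

        -- Greedily: discarding L[ r ] leaves vertices whose neighbourhoods in Z are disjoint from that of r.
        hall : ∀ k Rs → length Rs ℕ.≤ k → Rs ⊑ V → (∀ {r} → r ∈ Rs → N r) → + length Rs ≤ ζ Rs
        hall k       []       _        _     _    = ∑-nonneg V (λ u → ind-nonneg (reached? [] u))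
        hall (suc k) (r ∷ Rs) (s≤s |Rs|≤k) r∷Rs⊑V r∷Rs⊆N =
          hall-step τ _ (+ length Rs′) (dL y) (dL r) (ζ (r ∷ [])) _ (ζ Rs′) small
            (subst (λ Qs → _ ≤ dL r + 1ℤ + + length Qs) (filter-reject (¬? ∘ L[ r ]?) (λ ¬L[r]r → ¬L[r]r (inj₂ refl)))
              (remove-L[] r (r ∷ Rs) r∷Rs⊑V))
            (hall k Rs′ (ℕ.≤-trans (length-filter (¬? ∘ L[ r ]?) Rs) |Rs|≤k)
              (λ f p → ≤-trans (filter-⊑ _ Rs f p) (≤-trans (tail-⊑ r Rs f p) (r∷Rs⊑V f p)))
              (λ s∈ → r∷Rs⊆N (there (proj₁ (∈-filter⁻ (¬? ∘ L[ r ]?) s∈)))))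
            (ζ-add Rs′ (r∷Rs⊆N (here refl)) (here refl) (λ s∈ → let s∈Rs , ¬L[r]s = ∈-filter⁻ (¬? ∘ L[ r ]?) s∈ in
              there s∈Rs , r∷Rs⊆N (there s∈Rs) , ¬L[r]s))
            (ζ-single (r∷Rs⊆N (here refl)))
          where
          Rs′ : List A
          Rs′ = filter (¬? ∘ L[ r ]?) Rs

        -- If `r` and `s` were not joined by `L`, the greedy argument could start with both of them.
        -- Keeping the exact gain of these two steps, and using `hall` for the rest, makes the
        -- reached part of `Z` too large to fit beside the `H`- and `L`-neighbours of `y`.
        clique : ∀ {r s} → N r → N s → r ≢ s → L r s
        clique {r} {s} Nr@(r∈V , yr) Ns@(s∈V , ys) r≢s with L? r s
        ... | yes rs = rs
        ... | no ¬rs = ⊥-elim (clique-overflow τ (+ length V) (dH y) (+ length R₁) (+ length R₂) (dL y) (dL r) (dL s)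
            (ζ (r ∷ [])) (ζ (s ∷ [])) (ζ R) (ζ R₁) (ζ R₂) n+5≤4τ (dL-nonneg y) (clean-degree y∈V)
            (subst (_≤ dL r + 1ℤ + + length R₁) (∑-filter (H? y) V) (remove-L[] r R (filter-⊑ (H? y) V)))
            (remove-L[] s R₁ R₁⊑V)
            (hall (length R₂) R₂ ℕ.≤-refl (λ f p → ≤-trans (filter-⊑ _ R₁ f p) (R₁⊑V f p))
              (R₁⊆N ∘ proj₁ ∘ ∈-filter⁻ (¬? ∘ L[ s ]?)))
            (ζ-add R₁ Nr (N⇒∈R Nr) (λ q∈ → let q∈R , ¬L[r]q = ∈-filter⁻ (¬? ∘ L[ r ]?) q∈ in q∈R , ∈R⇒N q∈R , ¬L[r]q))
            (ζ-add R₂ Ns (∈-filter⁺ (¬? ∘ L[ r ]?) (N⇒∈R Ns) λ { (inj₁ rs) → ¬rs rs ; (inj₂ s≡r) → r≢s (sym s≡r) })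
              (λ q∈ → let q∈R₁ , ¬L[s]q = ∈-filter⁻ (¬? ∘ L[ s ]?) q∈ in q∈R₁ , R₁⊆N q∈R₁ , ¬L[s]q))
            (ζ-single Nr) (ζ-single Ns) total)
          where
          R R₁ R₂ : List A
          R  = filter (H? y) V
          R₁ = filter (¬? ∘ L[ r ]?) R
          R₂ = filter (¬? ∘ L[ s ]?) R₁
          N⇒∈R : ∀ {q} → N q → q ∈ R
          N⇒∈R (q∈V , yq) = ∈-filter⁺ (H? y) q∈V yq
          ∈R⇒N : ∀ {q} → q ∈ R → N q
          ∈R⇒N = ∈-filter⁻ (H? y)
          R₁⊆N : ∀ {q} → q ∈ R₁ → N q
          R₁⊆N = ∈R⇒N ∘ proj₁ ∘ ∈-filter⁻ (¬? ∘ L[ r ]?)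
          R₁⊑V : R₁ ⊑ V
          R₁⊑V f p = ≤-trans (filter-⊑ _ R f p) (filter-⊑ (H? y) V f p)
          pointwise : ∀ u → h y u + l y u + ind (reached? R u) ≤ 1ℤ
          pointwise u = cases (H? y u) (L? y u) (reached? R u)
            where
            cases : (a : Dec (H y u)) (b : Dec (L y u)) (c : Dec (Reached R u)) → ind a + ind b + ind c ≤ 1ℤ
            cases (yes yu) (yes yu′) _                          = ⊥-elim (H⇒¬L yu yu′)
            cases (yes yu) (no _)    (yes ((¬yu , _) , _))      = ⊥-elim (¬yu yu)
            cases (no _)   (yes yu)  (yes ((_ , ¬yu , _) , _))  = ⊥-elim (¬yu yu)
            cases (yes _)  (no _)    (no _)                     = ≤-refl
            cases (no _)   (yes _)   (no _)                     = ≤-refl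
            cases (no _)   (no _)    (yes _)                    = ≤-refl
            cases (no _)   (no _)    (no _)                     = +≤+ z≤n
          total : dH y + dL y + ζ R ≤ + length V
          total = ≤-trans (≤-reflexive (sym (trans (∑-+ V _ _) (cong (λ i → i + ζ R) (∑-+ V (h y) (l y))))))
            (≤-trans (∑-mono V (λ {u} _ → pointwise u)) (≤-reflexive (∑-length V)))

      -- The vertices destined for `V₀`. By integrality every other vertex has `dL` at most `τ - 2`,
      -- as `Neighbourhood` requires.
      Large : A → Set
      Large x = τ - 1ℤ ≤ dL x

      large? : ∀ x → Dec (Large x)
      large? x = τ - 1ℤ ≤? dL x

      -- Each of the two has at least `2τ - 1` `H`-neighbours, and `4τ - 2` exceeds the number of
      -- vertices.
      common-neighbour : ∀ {x y} → x ∈ V → y ∈ V → Large x → Large y → ∃ λ s → s ∈ V × H x s × H y s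
      common-neighbour {x} {y} x∈V y∈V large-x large-y with any? (λ s → H? x s ×-dec H? y s) V
      ... | yes some = find some
      ... | no none  = ⊥-elim (disjoint-neighbourhoods-overflow τ (+ length V) (dL x) (dL y) (dH x) (dH y) n+5≤4τ large-x large-y
          (clean-degree x∈V) (clean-degree y∈V)
          (≤-trans (≤-reflexive (sym (∑-+ V (h x) (h y)))) (≤-trans (∑-mono V pointwise) (≤-reflexive (∑-length V)))))
        where
        pointwise : ∀ {s} → s ∈ V → h x s + h y s ≤ 1ℤ
        pointwise {s} s∈V with H? x s | H? y s
        ... | yes xs | yes ys = ⊥-elim (none (Any.map (λ { refl → xs , ys }) s∈V))
        ... | yes _  | no _   = ≤-refl
        ... | no _   | yes _  = ≤-refl
        ... | no _   | no _   = +≤+ z≤n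

      large-independent : ∀ {x y} → x ∈ V → y ∈ V → Large x → Large y → ¬ H x y
      large-independent x∈V y∈V large-x large-y xy with s , s∈V , xs , ys ← common-neighbour x∈V y∈V large-x large-y =
        triangle-free x∈V y∈V s∈V xy xs ys

      -- A common `H`-neighbour `s` cannot be `Large`, by `large-independent`, so its
      -- `H`-neighbourhood, which contains `x` and `y`, is an `L`-clique.
      large-clique : ∀ {x y} → x ∈ V → y ∈ V → x ≢ y → Large x → Large y → L x y
      large-clique x∈V y∈V x≢y large-x large-y with s , s∈V , xs , ys ← common-neighbour x∈V y∈V large-x large-y =
        Neighbourhood.clique s∈V (small-from τ _ (≰⇒suc≤ (λ large-s → large-independent x∈V s∈V large-x large-s xs)))
          (x∈V , H-sym xs) (y∈V , H-sym ys) x≢y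

      -- The `H`-neighbourhood of `x` is an `L`-clique. If it contained `y`, all its other members
      -- would be `L`-neighbours of `y`, at least `τ - 1` of them, and `y` would be `Large`.
      small-independent : ∀ {x y} → x ∈ V → y ∈ V → ¬ Large x → ¬ Large y → ¬ H x y
      small-independent {x} {y} x∈V y∈V small-x small-y xy =
        small-y (large-from τ (dL x) (dL y) (dH x) (dL-nonneg x) (clean-degree x∈V)
          (≤-trans (∑-mono V pointwise) (≤-trans (≤-reflexive (∑-+ V (l y) (λ u → ind (u ≟ y))))
            (+-monoʳ-≤ (dL y) (∑-ind-≟≤1 _≟_ V-unique y)))))
        where
        pointwise : ∀ {u} → u ∈ V → h x u ≤ l y u + ind (u ≟ y)
        pointwise {u} u∈V with H? x u | L? y u | u ≟ y
        ... | no _   | d      | e       = ind-nonneg d ⊞ ind-nonneg e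
        ... | yes _  | yes _  | e       = +-monoʳ-≤ 1ℤ (ind-nonneg e)
        ... | yes _  | no _   | yes _   = ≤-refl
        ... | yes xu | no ¬yu | no u≢y  = ⊥-elim (¬yu (Neighbourhood.clique x∈V (small-from τ _ (≰⇒suc≤ small-x))
                                            (y∈V , xy) (u∈V , xu) (u≢y ∘ sym)))

-- Numerical inequalities for part sizes and powers

open IntegerArithmetic using (≰⇒suc≤)
open Integers using (∑; ∑-↭; module Structure)
open import Data.Nat hiding (_/_; _%_; _≟_; _<?_)
open import Data.Nat.DivMod using (_/_; _%_; m≡m%n+[m/n]*n; m%n<n; m/n*n≤m; /-monoˡ-≤)
open import Data.Nat.Properties hiding (_≟_; _<?_)
open import Data.Nat.Tactic.RingSolver using (solve-∀)

≤-by : ∀ {L R l r} k → L ≤ R → L ≡ l + k → R ≡ r + k → l ≤ r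
≤-by {l = l} {r} k L≤R refl refl = +-cancelʳ-≤ k l r L≤R

-- The binomial coefficient `n` over 2, in the form that adding one vertex to `n` others creates `n`
-- new pairs.
tri : ℕ → ℕ
tri zero    = 0
tri (suc n) = n + tri n

tri-+ : ∀ k l → tri (k + l) ≡ tri k + tri l + k * l
tri-+ zero    l = sym (+-identityʳ _)
tri-+ (suc k) l rewrite tri-+ k l = rearrange k l (tri k) (tri l)
  where
  rearrange : ∀ k l s t → k + l + (s + t + k * l) ≡ k + s + t + (l + k * l)
  rearrange = solve-∀

2*tri : ∀ n → 2 * tri n + n ≡ n * n
2*tri zero    = refl
2*tri (suc n) = begin
  2 * (n + tri n) + suc n          ≡⟨ regroup n (tri n) ⟩
  (2 * tri n + n) + (1 + 2 * n)    ≡⟨ cong (_+ (1 + 2 * n)) (2*tri n) ⟩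
  n * n + (1 + 2 * n)              ≡⟨ square n ⟩
  suc n * suc n ∎
  where
  open ≡-Reasoning
  regroup : ∀ n t → 2 * (n + t) + (1 + n) ≡ (2 * t + n) + (1 + 2 * n)
  regroup = solve-∀
  square : ∀ n → n * n + (1 + 2 * n) ≡ (1 + n) * (1 + n)
  square = solve-∀

^-distribʳ-* : ∀ n x y → (x * y) ^ n ≡ x ^ n * y ^ n
^-distribʳ-* zero    x y = refl
^-distribʳ-* (suc n) x y = begin
  x * y * (x * y) ^ n       ≡⟨ cong (x * y *_) (^-distribʳ-* n x y) ⟩
  x * y * (x ^ n * y ^ n)   ≡⟨ [m*n]*[o*p]≡[m*o]*[n*p] x y (x ^ n) (y ^ n) ⟩
  x * x ^ n * (y * y ^ n)   ∎
  where open ≡-Reasoning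

^-cancelˡ-≤ : ∀ k {m n} → m ^ suc k ≤ n ^ suc k → m ≤ n
^-cancelˡ-≤ k {m} {n} p with m ≤? n
... | yes m≤n = m≤n
... | no m≰n  = contradiction p (<⇒≱ (^-monoˡ-< (suc k) (≰⇒> m≰n)))

-- The inequality of arithmetic and geometric means for `v + 4`, `v + 4`, `v + 4`, `v`, whose mean
-- is `v + 3`.
fourth-power : ∀ v → (v + 4) * (v + 4) * ((v + 4) * v) ≤ (v + 3) ^ 4
fourth-power v = subst ((v + 4) * (v + 4) * ((v + 4) * v) ≤_) (quartic v) (m≤m+n _ (6 * (v * v) + 44 * v + 81))
  where
  quartic : ∀ v → (v + 4) * (v + 4) * ((v + 4) * v) + (6 * (v * v) + 44 * v + 81)
            ≡ (v + 3) * ((v + 3) * ((v + 3) * ((v + 3) * 1)))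
  quartic = solve-∀

-- Five of the eleven factors are traded for `v * c ^ 3`; the other six are `(v + 4) ^ 3`, and
-- together with `v` they are bounded by `(v + 3) ^ 4 = (b * c) ^ 4`.
eleventh-power : ∀ a b c v → a * a ≡ v + 4 → b * c ≡ v + 3 → a ^ 5 ≤ v * c ^ 3 → a ^ 11 ≤ b ^ 4 * c ^ 7
eleventh-power a b c v a² bc a⁵≤ = begin
  a ^ 11                                   ≡⟨ ^-distribˡ-+-* a 6 5 ⟩
  a ^ 6 * a ^ 5                            ≤⟨ *-monoʳ-≤ (a ^ 6) a⁵≤ ⟩
  a ^ 6 * (v * c ^ 3)                      ≡⟨ *-assoc (a ^ 6) v (c ^ 3) ⟨
  a ^ 6 * v * c ^ 3                        ≡⟨ cong (_* c ^ 3) (sixth a v) ⟩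
  a * a * (a * a) * (a * a * v) * c ^ 3    ≡⟨ cong (λ y → y * y * (y * v) * c ^ 3) a² ⟩
  (v + 4) * (v + 4) * ((v + 4) * v) * c ^ 3 ≤⟨ *-monoˡ-≤ (c ^ 3) (fourth-power v) ⟩
  (v + 3) ^ 4 * c ^ 3                      ≡⟨ cong (λ z → z ^ 4 * c ^ 3) bc ⟨
  (b * c) ^ 4 * c ^ 3                      ≡⟨ cong (_* c ^ 3) (^-distribʳ-* 4 b c) ⟩
  b ^ 4 * c ^ 4 * c ^ 3                    ≡⟨ *-assoc (b ^ 4) (c ^ 4) (c ^ 3) ⟩
  b ^ 4 * (c ^ 4 * c ^ 3)                  ≡⟨ cong (b ^ 4 *_) (^-distribˡ-+-* c 4 3) ⟨
  b ^ 4 * c ^ 7 ∎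
  where
  open ≤-Reasoning
  sixth : ∀ a v → a * (a * (a * (a * (a * (a * 1))))) * v ≡ a * a * (a * a) * (a * a * v)
  sixth = solve-∀

-- For a ≥ 3 apply eleventh-power with v = a² ∸ 4 = (a ∸ 2)(a + 2).
base-power : ∀ d → (2 + d) ^ 11 ≤ (1 + d) ^ 4 * (3 + d) ^ 7
base-power zero    = ≤ᵇ⇒≤ (2 ^ 11) (1 * 3 ^ 7) _
base-power (suc e) = eleventh-power (3 + e) (2 + e) (4 + e) ((1 + e) * (5 + e)) (square e) (neighbours e)
  (m+n≤o⇒m≤o ((3 + e) ^ 5) (≤-reflexive (quintic e)))
  where
  square : ∀ e → (3 + e) * (3 + e) ≡ (1 + e) * (5 + e) + 4
  square = solve-∀
  neighbours : ∀ e → (2 + e) * (4 + e) ≡ (1 + e) * (5 + e) + 3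
  neighbours = solve-∀
  quintic : ∀ e → (3 + e) * ((3 + e) * ((3 + e) * ((3 + e) * ((3 + e) * 1)))) + (77 + e * (219 + e * (142 + e * (35 + e * 3))))
            ≡ (1 + e) * (5 + e) * ((4 + e) * ((4 + e) * ((4 + e) * 1)))
  quintic = solve-∀

-- With `n = k + l`, `k ≤ s - 1` and `s ≤ (n + 5) / 4`: `4l - 4s - 7k = 4n - 11k - 4s ≥ 4n - 15s +
-- 11 ≥ (n - 31) / 4 ≥ 0`. The certificate is this chain multiplied by 4.
few-in-V₀ : ∀ k l s → 32 ≤ k + l → 4 * s ≤ 5 + (k + l) → k < s → ∃ λ j → s + j ≡ l × 7 * k ≤ 4 * j
few-in-V₀ k l s 32≤n 4s≤ k<s = j , eq ,
  +-cancelˡ-≤ (4 * s) _ _ (≤-trans sized (≤-reflexive (trans (cong (4 *_) (sym eq)) (*-distribˡ-+ 4 s j))))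
  where
  lhs : ∀ s k → 44 * (1 + k) + 15 * (4 * s) + 31 ≡ 4 * (4 * s + 7 * k) + (75 + 44 * s + 16 * k)
  lhs = solve-∀
  rhs : ∀ s k l → 44 * s + 15 * (5 + (k + l)) + (k + l) ≡ 4 * (4 * l) + (75 + 44 * s + 16 * k)
  rhs = solve-∀
  sized : 4 * s + 7 * k ≤ 4 * l
  sized = *-cancelˡ-≤ 4 (≤-by (75 + 44 * s + 16 * k)
    (+-mono-≤ (+-mono-≤ (*-monoʳ-≤ 44 k<s) (*-monoʳ-≤ 15 4s≤)) (≤-trans (n≤1+n 31) 32≤n)) (lhs s k) (rhs s k l))
  s≤l : s ≤ l
  s≤l = *-cancelˡ-≤ 4 (m+n≤o⇒m≤o (4 * s) sized)
  j : ℕ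
  j = l ∸ s
  eq : s + j ≡ l
  eq = m+[n∸m]≡n s≤l

-- After substituting the sizes, what remains is `15q² + 2qr + 28q ≥ 135q + r² + 9r + K`. Using
-- `q ≥ 33` once turns the excess of the left side in `q` into `388q`, where
-- `388 = 15 * 33 + 28 - 135`; using it again gives `388 * 33`.
balanced-size : ∀ K q r X t → let k = 4 * q; l = 11 * q + r; n = k + l in
  14 * 14 + 9 * 14 + K ≤ 388 * 33 → 33 ≤ q → r ≤ 14 → 2 * t + k ≡ k * k → 8 * X ≤ n * n + 9 * n + K →
  8 * X + 7 * (2 * t) ≤ 8 * (k * l)
balanced-size K q r X t K≤ 33≤q r≤14 2t+k 8X≤ = +-cancelʳ-≤ (7 * (4 * q)) _ _ (begin
    8 * X + 7 * (2 * t) + 7 * (4 * q)           ≡⟨ group (8 * X) (2 * t) (4 * q) ⟩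
    8 * X + 7 * (2 * t + 4 * q)                 ≡⟨ cong (λ z → 8 * X + 7 * z) 2t+k ⟩
    8 * X + 7 * (4 * q * (4 * q))               ≤⟨ +-monoˡ-≤ _ 8X≤ ⟩
    n * n + 9 * n + K + 7 * (4 * q * (4 * q))   ≡⟨ expand K q r ⟩
    r * r + 9 * r + K + (337 * (q * q) + 30 * (q * r) + 135 * q)
      ≤⟨ +-monoˡ-≤ _ (+-monoˡ-≤ K (+-mono-≤ (*-mono-≤ r≤14 r≤14) (*-monoʳ-≤ 9 r≤14))) ⟩
    14 * 14 + 9 * 14 + K + (337 * (q * q) + 30 * (q * r) + 135 * q)
      ≤⟨ +-monoˡ-≤ _ (≤-trans K≤ (*-monoʳ-≤ 388 33≤q)) ⟩
    388 * q + (337 * (q * q) + 30 * (q * r) + 135 * q)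
      ≡⟨ regroup q r ⟩
    15 * (33 * q) + (337 * (q * q) + 30 * (q * r) + 28 * q)
      ≤⟨ +-monoˡ-≤ _ (*-monoʳ-≤ 15 (*-monoˡ-≤ q 33≤q)) ⟩
    15 * (q * q) + (337 * (q * q) + 30 * (q * r) + 28 * q)
      ≤⟨ m+n≤o⇒m≤o _ (≤-reflexive (total q r)) ⟩
    8 * (4 * q * (11 * q + r)) + 7 * (4 * q) ∎)
  where
  open ≤-Reasoning
  n : ℕ
  n = 4 * q + (11 * q + r)
  group : ∀ x y z → x + 7 * y + 7 * z ≡ x + 7 * (y + z)
  group = solve-∀
  expand : ∀ K q r → (4 * q + (11 * q + r)) * (4 * q + (11 * q + r)) + 9 * (4 * q + (11 * q + r)) + K + 7 * (4 * q * (4 * q))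
           ≡ r * r + 9 * r + K + (337 * (q * q) + 30 * (q * r) + 135 * q)
  expand = solve-∀
  regroup : ∀ q r → 388 * q + (337 * (q * q) + 30 * (q * r) + 135 * q)
            ≡ 15 * (33 * q) + (337 * (q * q) + 30 * (q * r) + 28 * q)
  regroup = solve-∀
  total : ∀ q r → 15 * (q * q) + (337 * (q * q) + 30 * (q * r) + 28 * q) + 2 * (q * r)
          ≡ 8 * (4 * q * (11 * q + r)) + 7 * (4 * q)
  total = solve-∀

-- Part sizes k = 4q and l = 11q + r for n = 15q + r: the optimal ratio if (a ∸ 1)⁴(a + 1)⁷ were a¹¹.
balanced : ∀ n X → 503 ≤ n → 8 * X ≤ n * n + 9 * n + 9000 →
           ∃ λ k → ∃₂ λ l j → k + l ≡ n × X + j ≡ k * l × 7 * tri k ≤ 4 * j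
balanced n X 503≤n 8X≤ = k , l , j , k+l≡n , eq , *-cancelˡ-≤ 2 (≤-trans (≤-reflexive (twice (tri k)))
    (+-cancelˡ-≤ (8 * X) _ _ (≤-trans sized (≤-reflexive (trans (cong (8 *_) (sym eq)) (eightfold X j))))))
  where
  q r k l : ℕ
  q = n / 15
  r = n % 15
  k = 4 * q
  l = 11 * q + r
  k+l≡n : k + l ≡ n
  k+l≡n = trans (collect q r) (sym (m≡m%n+[m/n]*n n 15))
    where
    collect : ∀ q r → 4 * q + (11 * q + r) ≡ r + q * 15
    collect = solve-∀
  twice : ∀ t → 2 * (7 * t) ≡ 7 * (2 * t)
  twice = solve-∀
  eightfold : ∀ X j → 8 * (X + j) ≡ 8 * X + 2 * (4 * j)
  eightfold = solve-∀
  sized : 8 * X + 7 * (2 * tri k) ≤ 8 * (k * l)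
  sized = balanced-size 9000 q r X (tri k) (≤ᵇ⇒≤ _ _ _) (/-monoˡ-≤ 15 503≤n) (≤-pred (m%n<n n 15)) (2*tri k)
            (subst (λ n → 8 * X ≤ n * n + 9 * n + 9000) (sym k+l≡n) 8X≤)
  X≤kl : X ≤ k * l
  X≤kl = *-cancelˡ-≤ 8 (m+n≤o⇒m≤o (8 * X) sized)
  j : ℕ
  j = k * l ∸ X
  eq : X + j ≡ k * l
  eq = m+[n∸m]≡n X≤kl

-- Products compared with powers of `a - 1`, `a`, `a + 1`

module Powers (b a c : ℕ) (a≡1+b : a ≡ suc b) (c≡1+a : c ≡ suc a) (1≤b : 1 ≤ b) where

  open ≤-Reasoning

  instance
    a≢0 : NonZero a
    a≢0 = subst NonZero (sym a≡1+b) _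

    c≢0 : NonZero c
    c≢0 = subst NonZero (sym c≡1+a) _

  a≤c : a ≤ c
  a≤c = subst (a ≤_) (sym c≡1+a) (n≤1+n a)

  b≤a : b ≤ a
  b≤a = subst (b ≤_) (sym a≡1+b) (n≤1+n b)

  a¹¹≤b⁴c⁷ : a ^ 11 ≤ b ^ 4 * c ^ 7
  a¹¹≤b⁴c⁷ = from b a c a≡1+b c≡1+a 1≤b
    where
    from : ∀ b a c → a ≡ suc b → c ≡ suc a → 1 ≤ b → a ^ 11 ≤ b ^ 4 * c ^ 7
    from (suc d) _ _ refl refl _ = base-power d

  -- On fourth powers: writing `4j = 7k + i`, the exponent `4k + 4j` is `11k + i`. Apply `a¹¹≤b⁴c⁷`
  -- to `k` blocks of eleven and `a ≤ c` to the remaining `i` factors.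
  light : ∀ k j → 7 * k ≤ 4 * j → a ^ (k + j) ≤ b ^ k * c ^ j
  light k j 7k≤4j with i , eq ← m≤n⇒∃[o]m+o≡n 7k≤4j = ^-cancelˡ-≤ 3 (begin
    (a ^ (k + j)) ^ 4                   ≡⟨ ^-*-assoc a (k + j) 4 ⟩
    a ^ ((k + j) * 4)                   ≡⟨ cong (a ^_) (exponent k j) ⟩
    a ^ (4 * k + 4 * j)                 ≡⟨ cong (λ e → a ^ (4 * k + e)) eq ⟨
    a ^ (4 * k + (7 * k + i))           ≡⟨ cong (a ^_) (eleven k i) ⟩
    a ^ (11 * k + i)                    ≡⟨ ^-distribˡ-+-* a (11 * k) i ⟩
    a ^ (11 * k) * a ^ i                ≡⟨ cong (_* a ^ i) (^-*-assoc a 11 k) ⟨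
    (a ^ 11) ^ k * a ^ i                ≤⟨ *-mono-≤ (^-monoˡ-≤ k a¹¹≤b⁴c⁷) (^-monoˡ-≤ i a≤c) ⟩
    (b ^ 4 * c ^ 7) ^ k * c ^ i         ≡⟨ cong (_* c ^ i) (^-distribʳ-* k (b ^ 4) (c ^ 7)) ⟩
    (b ^ 4) ^ k * (c ^ 7) ^ k * c ^ i   ≡⟨ cong₂ (λ x y → x * y * c ^ i) (^-*-assoc b 4 k) (^-*-assoc c 7 k) ⟩
    b ^ (4 * k) * c ^ (7 * k) * c ^ i   ≡⟨ *-assoc (b ^ (4 * k)) _ _ ⟩
    b ^ (4 * k) * (c ^ (7 * k) * c ^ i) ≡⟨ cong (b ^ (4 * k) *_) (^-distribˡ-+-* c (7 * k) i) ⟨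
    b ^ (4 * k) * c ^ (7 * k + i)       ≡⟨ cong (λ e → b ^ (4 * k) * c ^ e) eq ⟩
    b ^ (4 * k) * c ^ (4 * j)           ≡⟨ cong₂ (λ x y → b ^ x * c ^ y) (*-comm 4 k) (*-comm 4 j) ⟩
    b ^ (k * 4) * c ^ (j * 4)           ≡⟨ cong₂ _*_ (^-*-assoc b k 4) (^-*-assoc c j 4) ⟨
    (b ^ k) ^ 4 * (c ^ j) ^ 4           ≡⟨ ^-distribʳ-* 4 (b ^ k) (c ^ j) ⟨
    (b ^ k * c ^ j) ^ 4 ∎)
    where
    exponent : ∀ k j → (k + j) * 4 ≡ 4 * k + 4 * j
    exponent = solve-∀
    eleven : ∀ k i → 4 * k + (7 * k + i) ≡ 11 * k + i
    eleven = solve-∀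

  -- Division-free form of N ≤ a ^ E * ((a + 1) / a) ^ X.
  Excess : ℕ → ℕ → ℕ → Set
  Excess N E X = N * a ^ X ≤ a ^ E * c ^ X

  Excess-* : ∀ {N E X N′ E′ X′} → Excess N E X → Excess N′ E′ X′ → Excess (N * N′) (E + E′) (X + X′)
  Excess-* {N} {E} {X} {N′} {E′} {X′} p q = begin
    N * N′ * a ^ (X + X′)           ≡⟨ cong (N * N′ *_) (^-distribˡ-+-* a X X′) ⟩
    N * N′ * (a ^ X * a ^ X′)       ≡⟨ [m*n]*[o*p]≡[m*o]*[n*p] N N′ _ _ ⟩
    N * a ^ X * (N′ * a ^ X′)       ≤⟨ *-mono-≤ p q ⟩
    a ^ E * c ^ X * (a ^ E′ * c ^ X′) ≡⟨ [m*n]*[o*p]≡[m*o]*[n*p] (a ^ E) _ _ _ ⟩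
    a ^ E * a ^ E′ * (c ^ X * c ^ X′) ≡⟨ cong₂ _*_ (^-distribˡ-+-* a E E′) (^-distribˡ-+-* c X X′) ⟨
    a ^ (E + E′) * c ^ (X + X′) ∎

  Excess-≤ : ∀ {N N′ E X} → N ≤ N′ → Excess N′ E X → Excess N E X
  Excess-≤ {X = X} N≤N′ p = ≤-trans (*-monoˡ-≤ (a ^ X) N≤N′) p

  -- Bernoulli's inequality for `(1 + 1/a) ^ j`, cleared of denominators.
  bernoulli⁺ : ∀ j → (a + j) * a ^ j ≤ a * c ^ j
  bernoulli⁺ zero    = ≤-reflexive (cong (_* 1) (+-identityʳ a))
  bernoulli⁺ (suc j) = begin
    (a + suc j) * (a * a ^ j)  ≡⟨ *-assoc (a + suc j) a (a ^ j) ⟨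
    (a + suc j) * a * a ^ j    ≤⟨ *-monoˡ-≤ (a ^ j) step ⟩
    c * (a + j) * a ^ j        ≡⟨ *-assoc c (a + j) (a ^ j) ⟩
    c * ((a + j) * a ^ j)      ≤⟨ *-monoʳ-≤ c (bernoulli⁺ j) ⟩
    c * (a * c ^ j)            ≡⟨ x*[y*z]≡y*[x*z] c a (c ^ j) ⟩
    a * (c * c ^ j) ∎
    where
    x*[y*z]≡y*[x*z] : ∀ x y z → x * (y * z) ≡ y * (x * z)
    x*[y*z]≡y*[x*z] = solve-∀
    step : (a + suc j) * a ≤ c * (a + j)
    step rewrite c≡1+a = m+n≤o⇒m≤o ((a + suc j) * a) (≤-reflexive (identity a j))
      where
      identity : ∀ a j → (a + (1 + j)) * a + j ≡ (1 + a) * (a + j)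
      identity = solve-∀

  -- Climbing from `w` to `a` in unit steps multiplies by `(w + 1) / w` each time, which is at least
  -- `c / a` while `w ≤ a`.
  bernoulli⁻ : ∀ w j → w + j ≡ a → w * c ^ j ≤ a * a ^ j
  bernoulli⁻ w zero    eq = ≤-reflexive (cong (_* 1) (trans (sym (+-identityʳ w)) eq))
  bernoulli⁻ w (suc j) eq = begin
    w * (c * c ^ j)       ≡⟨ *-assoc w c (c ^ j) ⟨
    w * c * c ^ j         ≤⟨ *-monoˡ-≤ (c ^ j) step ⟩
    a * suc w * c ^ j     ≡⟨ *-assoc a (suc w) (c ^ j) ⟩
    a * (suc w * c ^ j)   ≤⟨ *-monoʳ-≤ a (bernoulli⁻ (suc w) j (trans (sym (+-suc w j)) eq)) ⟩
    a * (a * a ^ j) ∎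
    where
    step : w * c ≤ a * suc w
    step rewrite c≡1+a | sym eq = m+n≤o⇒m≤o (w * suc (w + suc j)) (≤-reflexive (identity w j))
      where
      identity : ∀ w j → w * (1 + (w + (1 + j))) + (1 + j) ≡ (w + (1 + j)) * (1 + w)
      identity = solve-∀

  -- States `w ≤ a (c / a) ^ (w - a)` for either sign of the exponent, with both signs moved to
  -- where no subtraction occurs.
  bernoulli : ∀ w → w * (a ^ w * c ^ a) ≤ a * (a ^ a * c ^ w)
  bernoulli w with ≤-total a w
  ... | inj₁ a≤w with j , refl ← m≤n⇒∃[o]m+o≡n a≤w = begin
    (a + j) * (a ^ (a + j) * c ^ a)       ≡⟨ cong (λ x → (a + j) * (x * c ^ a)) (^-distribˡ-+-* a a j) ⟩
    (a + j) * (a ^ a * a ^ j * c ^ a)     ≡⟨ front (a + j) (a ^ a) (a ^ j) (c ^ a) ⟩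
    (a + j) * a ^ j * (a ^ a * c ^ a)     ≤⟨ *-monoˡ-≤ (a ^ a * c ^ a) (bernoulli⁺ j) ⟩
    a * c ^ j * (a ^ a * c ^ a)           ≡⟨ back a (c ^ j) (a ^ a) (c ^ a) ⟩
    a * (a ^ a * (c ^ a * c ^ j))         ≡⟨ cong (λ x → a * (a ^ a * x)) (^-distribˡ-+-* c a j) ⟨
    a * (a ^ a * c ^ (a + j)) ∎
    where
    front : ∀ x y z u → x * (y * z * u) ≡ x * z * (y * u)
    front = solve-∀
    back : ∀ x y z u → x * y * (z * u) ≡ x * (z * (u * y))
    back = solve-∀
  ... | inj₂ w≤a with j , eq ← m≤n⇒∃[o]m+o≡n w≤a = begin
    w * (a ^ w * c ^ a)                   ≡⟨ cong (λ x → w * (a ^ w * c ^ x)) eq ⟨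
    w * (a ^ w * c ^ (w + j))             ≡⟨ cong (λ x → w * (a ^ w * x)) (^-distribˡ-+-* c w j) ⟩
    w * (a ^ w * (c ^ w * c ^ j))         ≡⟨ front w (a ^ w) (c ^ w) (c ^ j) ⟩
    w * c ^ j * (a ^ w * c ^ w)           ≤⟨ *-monoˡ-≤ (a ^ w * c ^ w) (bernoulli⁻ w j eq) ⟩
    a * a ^ j * (a ^ w * c ^ w)           ≡⟨ back a (a ^ j) (a ^ w) (c ^ w) ⟩
    a * (a ^ w * a ^ j * c ^ w)           ≡⟨ cong (λ x → a * (x * c ^ w)) (^-distribˡ-+-* a w j) ⟨
    a * (a ^ (w + j) * c ^ w)             ≡⟨ cong (λ x → a * (a ^ x * c ^ w)) eq ⟩
    a * (a ^ a * c ^ w) ∎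
    where
    front : ∀ x y z u → x * (y * (z * u)) ≡ x * u * (y * z)
    front = solve-∀
    back : ∀ x y z u → x * y * (z * u) ≡ x * (z * y * u)
    back = solve-∀

  product-weighted : ∀ ws → product ws * (a ^ sum ws * c ^ (length ws * a)) ≤
                            a ^ length ws * (a ^ (length ws * a) * c ^ sum ws)
  product-weighted []       = ≤-refl
  product-weighted (w ∷ ws) = begin
    w * Π * (a ^ (w + s) * c ^ (a + n))
      ≡⟨ cong₂ (λ x y → w * Π * (x * y)) (^-distribˡ-+-* a w s) (^-distribˡ-+-* c a n) ⟩
    w * Π * (a ^ w * a ^ s * (c ^ a * c ^ n))
      ≡⟨ split w Π (a ^ w) (a ^ s) (c ^ a) (c ^ n) ⟩
    w * (a ^ w * c ^ a) * (Π * (a ^ s * c ^ n))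
      ≤⟨ *-mono-≤ (bernoulli w) (product-weighted ws) ⟩
    a * (a ^ a * c ^ w) * (a ^ m * (a ^ n * c ^ s))
      ≡⟨ merge a (a ^ a) (c ^ w) (a ^ m) (a ^ n) (c ^ s) ⟩
    a * a ^ m * (a ^ a * a ^ n * (c ^ w * c ^ s))
      ≡⟨ cong₂ (λ x y → a * a ^ m * (x * y)) (^-distribˡ-+-* a a n) (^-distribˡ-+-* c w s) ⟨
    a * a ^ m * (a ^ (a + n) * c ^ (w + s)) ∎
    where
    Π s m n : ℕ
    Π = product ws
    s = sum ws
    m = length ws
    n = m * a
    split : ∀ w p x y z u → w * p * (x * y * (z * u)) ≡ w * (x * z) * (p * (y * u))
    split = solve-∀
    merge : ∀ a x y z u v → a * (x * y) * (z * (u * v)) ≡ a * z * (x * u * (y * v))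
    merge = solve-∀

  -- If the sum falls short of its bound by `d`, the slack is absorbed by `a ^ d ≤ c ^ d`; then the
  -- common factor `a ^ n * c ^ n` is cancelled.
  product-excess : ∀ ws s → sum ws ≤ length ws * a + s → Excess (product ws) (length ws) s
  product-excess ws s sum≤ with d , eq ← m≤n⇒∃[o]m+o≡n sum≤ =
    *-cancelʳ-≤ _ _ (a ^ n * c ^ n) {{m*n≢0 (a ^ n) (c ^ n) {{m^n≢0 a n}} {{m^n≢0 c n}}}} (begin
      Π * a ^ s * (a ^ n * c ^ n)             ≡⟨ collect Π (a ^ s) (a ^ n) (c ^ n) ⟩
      Π * (a ^ n * a ^ s) * c ^ n             ≡⟨ cong (λ x → Π * x * c ^ n) (trans (sym (^-distribˡ-+-* a n s)) (trans (cong (a ^_) (sym eq)) (^-distribˡ-+-* a t d))) ⟩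
      Π * (a ^ t * a ^ d) * c ^ n             ≡⟨ uncollect Π (a ^ t) (a ^ d) (c ^ n) ⟩
      Π * (a ^ t * c ^ n) * a ^ d             ≤⟨ *-mono-≤ (product-weighted ws) (^-monoˡ-≤ d a≤c) ⟩
      a ^ m * (a ^ n * c ^ t) * c ^ d         ≡⟨ assoc (a ^ m) (a ^ n) (c ^ t) (c ^ d) ⟩
      a ^ m * (a ^ n * (c ^ t * c ^ d))       ≡⟨ cong (λ x → a ^ m * (a ^ n * x)) (trans (sym (^-distribˡ-+-* c t d)) (trans (cong (c ^_) eq) (^-distribˡ-+-* c n s))) ⟩
      a ^ m * (a ^ n * (c ^ n * c ^ s))       ≡⟨ swap (a ^ m) (a ^ n) (c ^ n) (c ^ s) ⟩
      a ^ m * c ^ s * (a ^ n * c ^ n) ∎)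
    where
    Π t m n : ℕ
    Π = product ws
    t = sum ws
    m = length ws
    n = m * a
    collect : ∀ p x y z → p * x * (y * z) ≡ p * (y * x) * z
    collect = solve-∀
    uncollect : ∀ p x y z → p * (x * y) * z ≡ p * (x * z) * y
    uncollect = solve-∀
    assoc : ∀ x y z u → x * (y * z) * u ≡ x * (y * (z * u))
    assoc = solve-∀
    swap : ∀ x y z u → x * (y * (z * u)) ≡ x * u * (y * z)
    swap = solve-∀

  -- The product of the two-part multigraph with `k` vertices in `V₀` and `l` in `V₁`.
  T : ℕ → ℕ → ℕ
  T k l = b ^ tri k * (a ^ tri l * c ^ (k * l))

  -- Raising the multiplicity inside `V₀` from `b` to `a` leaves only the excess of the `k * l`
  -- crossing pairs.
  T-excess : ∀ k l → Excess (T k l) (tri (k + l)) (k * l)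
  T-excess k l = begin
    b ^ tri k * (a ^ tri l * c ^ (k * l)) * a ^ (k * l)  ≤⟨ *-monoˡ-≤ (a ^ (k * l)) (*-monoˡ-≤ _ (^-monoˡ-≤ (tri k) b≤a)) ⟩
    a ^ tri k * (a ^ tri l * c ^ (k * l)) * a ^ (k * l)  ≡⟨ regroup (a ^ tri k) (a ^ tri l) (c ^ (k * l)) (a ^ (k * l)) ⟩
    a ^ tri k * a ^ tri l * a ^ (k * l) * c ^ (k * l)    ≡⟨ cong (λ x → x * a ^ (k * l) * c ^ (k * l)) (^-distribˡ-+-* a (tri k) (tri l)) ⟨
    a ^ (tri k + tri l) * a ^ (k * l) * c ^ (k * l)      ≡⟨ cong (_* c ^ (k * l)) (^-distribˡ-+-* a (tri k + tri l) (k * l)) ⟨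
    a ^ (tri k + tri l + k * l) * c ^ (k * l)            ≡⟨ cong (λ x → a ^ x * c ^ (k * l)) (tri-+ k l) ⟨
    a ^ tri (k + l) * c ^ (k * l) ∎
    where
    regroup : ∀ x y z u → x * (y * z) * u ≡ x * y * u * z
    regroup = solve-∀

  -- A vertex added to `V₁` has excess `k ≥ s` and no pair below `a`.
  add₁ : ∀ {D} k l s → s ≤ k → Excess D (k + l) s → D ≤ a ^ l * c ^ k
  add₁ {D} k l s s≤k p with i , refl ← m≤n⇒∃[o]m+o≡n s≤k =
    *-cancelʳ-≤ _ _ (a ^ s) {{m^n≢0 a s}} (begin
      D * a ^ s                            ≤⟨ p ⟩
      a ^ (s + i + l) * c ^ s              ≡⟨ cong (_* c ^ s) (trans (^-distribˡ-+-* a (s + i) l) (cong (_* a ^ l) (^-distribˡ-+-* a s i))) ⟩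
      a ^ s * a ^ i * a ^ l * c ^ s        ≤⟨ *-monoˡ-≤ (c ^ s) (*-monoˡ-≤ (a ^ l) (*-monoʳ-≤ (a ^ s) (^-monoˡ-≤ i a≤c))) ⟩
      a ^ s * c ^ i * a ^ l * c ^ s        ≡⟨ regroup (a ^ s) (c ^ i) (a ^ l) (c ^ s) ⟩
      a ^ l * (c ^ s * c ^ i) * a ^ s      ≡⟨ cong (λ x → a ^ l * x * a ^ s) (^-distribˡ-+-* c s i) ⟨
      a ^ l * c ^ (s + i) * a ^ s ∎)
    where
    regroup : ∀ x y z u → x * y * z * u ≡ z * (u * y) * x
    regroup = solve-∀

  -- A vertex added to `V₀` has `s + j` factors `c`: `s` of them match the excess of the deleted
  -- vertex, and by `light` the other `j` pay for the `k` factors `b`.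
  add₀ : ∀ {D} k s j → 7 * k ≤ 4 * j → Excess D (k + (s + j)) s → D ≤ b ^ k * c ^ (s + j)
  add₀ {D} k s j 7k≤4j p = *-cancelʳ-≤ _ _ (a ^ s) {{m^n≢0 a s}} (begin
    D * a ^ s                            ≤⟨ p ⟩
    a ^ (k + (s + j)) * c ^ s            ≡⟨ cong (λ x → a ^ x * c ^ s) (exponent k s j) ⟩
    a ^ (k + j + s) * c ^ s              ≡⟨ cong (_* c ^ s) (^-distribˡ-+-* a (k + j) s) ⟩
    a ^ (k + j) * a ^ s * c ^ s          ≤⟨ *-monoˡ-≤ (c ^ s) (*-monoˡ-≤ (a ^ s) (light k j 7k≤4j)) ⟩
    b ^ k * c ^ j * a ^ s * c ^ s        ≡⟨ regroup (b ^ k) (c ^ j) (a ^ s) (c ^ s) ⟩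
    b ^ k * (c ^ s * c ^ j) * a ^ s      ≡⟨ cong (λ x → b ^ k * x * a ^ s) (^-distribˡ-+-* c s j) ⟨
    b ^ k * c ^ (s + j) * a ^ s ∎)
    where
    exponent : ∀ k s j → k + (s + j) ≡ k + j + s
    exponent = solve-∀
    regroup : ∀ x y z u → x * y * z * u ≡ x * (u * y) * z
    regroup = solve-∀

  T-add₁ : ∀ k l → a ^ l * c ^ k * T k l ≡ T k (suc l)
  T-add₁ k l = begin-equality
    a ^ l * c ^ k * T k l                                     ≡⟨ regroup (a ^ l) (c ^ k) (b ^ tri k) (a ^ tri l) (c ^ (k * l)) ⟩
    b ^ tri k * (a ^ l * a ^ tri l * (c ^ k * c ^ (k * l)))   ≡⟨ cong₂ (λ x y → b ^ tri k * (x * y)) (^-distribˡ-+-* a l (tri l)) (^-distribˡ-+-* c k (k * l)) ⟨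
    b ^ tri k * (a ^ (l + tri l) * c ^ (k + k * l))           ≡⟨ cong (λ x → b ^ tri k * (a ^ (l + tri l) * c ^ x)) (*-suc k l) ⟨
    T k (suc l) ∎
    where
    regroup : ∀ x y z u v → x * y * (z * (u * v)) ≡ z * (x * u * (y * v))
    regroup = solve-∀

  T-add₀ : ∀ k l → b ^ k * c ^ l * T k l ≡ T (suc k) l
  T-add₀ k l = begin-equality
    b ^ k * c ^ l * T k l                                     ≡⟨ regroup (b ^ k) (c ^ l) (b ^ tri k) (a ^ tri l) (c ^ (k * l)) ⟩
    b ^ k * b ^ tri k * (a ^ tri l * (c ^ l * c ^ (k * l)))   ≡⟨ cong₂ (λ x y → x * (a ^ tri l * y)) (^-distribˡ-+-* b k (tri k)) (^-distribˡ-+-* c l (k * l)) ⟨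
    T (suc k) l ∎
    where
    regroup : ∀ x y z u v → x * y * (z * (u * v)) ≡ x * z * (u * (y * v))
    regroup = solve-∀

  T-grow : ∀ {D} k l s → 32 ≤ k + l → 4 * s ≤ 5 + (k + l) → Excess D (k + l) s →
           ∃₂ λ k′ l′ → k′ + l′ ≡ suc (k + l) × D * T k l ≤ T k′ l′
  T-grow {D} k l s 32≤n 4s≤ p with s ≤? k
  ... | yes s≤k = k , suc l , +-suc k l , subst (D * T k l ≤_) (T-add₁ k l) (*-monoˡ-≤ (T k l) (add₁ {D} k l s s≤k p))
  ... | no s≰k  = suc k , l , refl , subst (D * T k l ≤_) (T-add₀ k l) (*-monoˡ-≤ (T k l) D≤)
    where
    D≤ : D ≤ b ^ k * c ^ l
    D≤ = let j , s+j≡l , 7k≤4j = few-in-V₀ k l s 32≤n 4s≤ (≰⇒> s≰k) in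
      subst (λ l → D ≤ b ^ k * c ^ l) s+j≡l (add₀ {D} k s j 7k≤4j (subst (λ l → Excess D (k + l) s) (sym s+j≡l) p))

  -- Of the `k * l` crossing pairs, `X` match the given excess; the remaining `j` compensate, by
  -- `light`, for the `tri k` pairs inside `V₀`.
  ≤T : ∀ {N} k l X j → X + j ≡ k * l → 7 * tri k ≤ 4 * j → Excess N (tri (k + l)) X → N ≤ T k l
  ≤T {N} k l X j eq 7t≤4j p = *-cancelʳ-≤ _ _ (a ^ X) {{m^n≢0 a X}} (begin
    N * a ^ X                                    ≤⟨ p ⟩
    a ^ tri (k + l) * c ^ X                      ≡⟨ cong (λ x → a ^ x * c ^ X) (trans (tri-+ k l) (trans (cong (_+_ (tri k + tri l)) (sym eq)) (exponent (tri k) (tri l) X j))) ⟩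
    a ^ (tri k + j + (tri l + X)) * c ^ X        ≡⟨ cong (_* c ^ X) (trans (^-distribˡ-+-* a (tri k + j) (tri l + X)) (cong (a ^ (tri k + j) *_) (^-distribˡ-+-* a (tri l) X))) ⟩
    a ^ (tri k + j) * (a ^ tri l * a ^ X) * c ^ X ≤⟨ *-monoˡ-≤ (c ^ X) (*-monoˡ-≤ _ (light (tri k) j 7t≤4j)) ⟩
    b ^ tri k * c ^ j * (a ^ tri l * a ^ X) * c ^ X ≡⟨ regroup (b ^ tri k) (c ^ j) (a ^ tri l) (a ^ X) (c ^ X) ⟩
    b ^ tri k * (a ^ tri l * (c ^ X * c ^ j)) * a ^ X ≡⟨ cong (λ x → b ^ tri k * (a ^ tri l * x) * a ^ X) (trans (sym (^-distribˡ-+-* c X j)) (cong (c ^_) eq)) ⟩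
    T k l * a ^ X ∎)
    where
    exponent : ∀ s t x j → s + t + (x + j) ≡ s + j + (t + x)
    exponent = solve-∀
    regroup : ∀ x y z u v → x * y * (z * u) * v ≡ x * (z * (v * y)) * u
    regroup = solve-∀

  excess⇒≤T : ∀ {N} n X → 503 ≤ n → 8 * X ≤ n * n + 9 * n + 9000 → Excess N (tri n) X →
              ∃₂ λ k l → k + l ≡ n × N ≤ T k l
  excess⇒≤T {N} n X 503≤n 8X≤ p =
    let k , l , j , k+l≡n , eq , 7t≤4j = balanced n X 503≤n 8X≤ in
    k , l , k+l≡n , ≤T {N} k l X j eq 7t≤4j (subst (λ n → Excess N (tri n) X) (sym k+l≡n) p)

-- Values on the pairs of a list, and the two-part multigraphs

pairValues : (A → A → ℕ) → List A → List ℕ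
pairValues w []       = []
pairValues w (x ∷ xs) = map (w x) xs ++ pairValues w xs

length-pairValues : ∀ (w : A → A → ℕ) xs → length (pairValues w xs) ≡ tri (length xs)
length-pairValues w []       = refl
length-pairValues w (x ∷ xs) =
  trans (length-++ (map (w x) xs)) (cong₂ _+_ (length-map (w x) xs) (length-pairValues w xs))

pairValues-↭ : ∀ (w : A → A → ℕ) → (∀ x y → w x y ≡ w y x) → ∀ {xs ys} → xs ↭ ys → pairValues w xs ↭ pairValues w ys
pairValues-↭ w w-sym ↭.refl        = ↭.refl
pairValues-↭ w w-sym (↭.prep x p)  = ++⁺ (map⁺ (w x) p) (pairValues-↭ w w-sym p)
pairValues-↭ w w-sym (↭.swap {xs} x y p) = ↭-trans
  (↭-trans (↭-reflexive (cong (λ v → v ∷ map (w x) xs ++ map (w y) xs ++ pairValues w xs) (w-sym x y)))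
    (↭.prep (w y x) (shifts (map (w x) xs) (map (w y) xs))))
  (↭.prep (w y x) (++⁺ (map⁺ (w y) p) (++⁺ (map⁺ (w x) p) (pairValues-↭ w w-sym p))))
pairValues-↭ w w-sym (↭.trans p q) = ↭-trans (pairValues-↭ w w-sym p) (pairValues-↭ w w-sym q)

product-map-mono : ∀ {f g : A → ℕ} {xs} → All (λ x → f x ≤ g x) xs → product (map f xs) ≤ product (map g xs)
product-map-mono []       = ≤-refl
product-map-mono (p ∷ ps) = *-mono-≤ p (product-map-mono ps)

product-pairValues-mono : ∀ {f g : A → A → ℕ} {xs} → AllPairs (λ x y → f x y ≤ g x y) xs →
                          product (pairValues f xs) ≤ product (pairValues g xs)
product-pairValues-mono []       = ≤-refl
product-pairValues-mono {f = f} {g} {x ∷ xs} (p ∷ ps) = begin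
  product (map (f x) xs ++ pairValues f xs)          ≡⟨ product-++ (map (f x) xs) _ ⟩
  product (map (f x) xs) * product (pairValues f xs) ≤⟨ *-mono-≤ (product-map-mono p) (product-pairValues-mono ps) ⟩
  product (map (g x) xs) * product (pairValues g xs) ≡⟨ product-++ (map (g x) xs) _ ⟨
  product (map (g x) xs ++ pairValues g xs) ∎
  where open ≤-Reasoning

size₀ size₁ : (A → Fin 2) → List A → ℕ
size₀ part []       = 0
size₀ part (x ∷ xs) with part x
... | zero     = suc (size₀ part xs)
... | suc zero = size₀ part xs
size₁ part []       = 0
size₁ part (x ∷ xs) with part x
... | zero     = size₁ part xs
... | suc zero = suc (size₁ part xs)

size₀+size₁ : ∀ (part : A → Fin 2) xs → size₀ part xs + size₁ part xs ≡ length xs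
size₀+size₁ part []       = refl
size₀+size₁ part (x ∷ xs) with part x
... | zero     = cong suc (size₀+size₁ part xs)
... | suc zero = trans (+-suc _ _) (cong suc (size₀+size₁ part xs))

module Partition (b : ℕ) (1≤b : 1 ≤ b) {A : Set} (part : A → Fin 2) where

  a c : ℕ
  a = suc b
  c = suc a

  open Powers b a c refl refl 1≤b

  weight : A → A → ℕ
  weight x y = partWeight {2} a 1 (part x) (part y)

  product-row₀ : ∀ xs → product (map (λ y → partWeight {2} a 1 zero (part y)) xs) ≡ b ^ size₀ part xs * c ^ size₁ part xs
  product-row₀ []       = refl
  product-row₀ (x ∷ xs) with part x
  ... | zero     = trans (cong (b *_) (product-row₀ xs)) (sym (*-assoc b (b ^ size₀ part xs) (c ^ size₁ part xs)))
  ... | suc zero = trans (cong (c *_) (product-row₀ xs)) (exchange c (b ^ size₀ part xs) (c ^ size₁ part xs))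
    where
    exchange : ∀ x y z → x * (y * z) ≡ y * (x * z)
    exchange = solve-∀

  product-row₁ : ∀ xs → product (map (λ y → partWeight {2} a 1 (suc zero) (part y)) xs) ≡ a ^ size₁ part xs * c ^ size₀ part xs
  product-row₁ []       = refl
  product-row₁ (x ∷ xs) with part x
  ... | zero     = trans (cong (c *_) (product-row₁ xs)) (exchange c (a ^ size₁ part xs) (c ^ size₀ part xs))
    where
    exchange : ∀ x y z → x * (y * z) ≡ y * (x * z)
    exchange = solve-∀
  ... | suc zero = trans (cong (a *_) (product-row₁ xs)) (sym (*-assoc a (a ^ size₁ part xs) (c ^ size₀ part xs)))

  product-weight : ∀ xs → product (pairValues weight xs) ≡ T (size₀ part xs) (size₁ part xs)
  product-weight []       = refl
  product-weight (x ∷ xs) with part x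
  ... | zero     = trans (product-++ (map _ xs) _)
    (trans (cong₂ _*_ (product-row₀ xs) (product-weight xs)) (T-add₀ (size₀ part xs) (size₁ part xs)))
  ... | suc zero = trans (product-++ (map _ xs) _)
    (trans (cong₂ _*_ (product-row₁ xs) (product-weight xs)) (T-add₁ (size₀ part xs) (size₁ part xs)))

  sum-row₀ : ∀ xs → sum (map (λ y → partWeight {2} a 1 zero (part y)) xs) + size₀ part xs ≡ length xs * a + size₁ part xs
  sum-row₀ []       = refl
  sum-row₀ (x ∷ xs) with part x
  ... | zero     = trans (carry b (sum (map (λ y → partWeight {2} a 1 zero (part y)) xs)) (size₀ part xs)) (trans (cong (_+_ a) (sum-row₀ xs)) (sym (+-assoc a _ _)))
    where
    carry : ∀ b s k → b + s + (1 + k) ≡ (1 + b) + (s + k)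
    carry = solve-∀
  ... | suc zero = trans (+-assoc c (sum (map (λ y → partWeight {2} a 1 zero (part y)) xs)) (size₀ part xs)) (trans (cong (_+_ c) (sum-row₀ xs)) (heavy a (length xs * a) (size₁ part xs)))
    where
    heavy : ∀ a s k → (1 + a) + (s + k) ≡ a + s + (1 + k)
    heavy = solve-∀

  sum-row₁ : ∀ xs → sum (map (λ y → partWeight {2} a 1 (suc zero) (part y)) xs) ≡ length xs * a + size₀ part xs
  sum-row₁ []       = refl
  sum-row₁ (x ∷ xs) with part x
  ... | zero     = trans (cong (_+_ c) (sum-row₁ xs)) (heavy a (length xs * a) (size₀ part xs))
    where
    heavy : ∀ a s k → (1 + a) + (s + k) ≡ a + s + (1 + k)
    heavy = solve-∀
  ... | suc zero = trans (cong (_+_ a) (sum-row₁ xs)) (sym (+-assoc a _ _))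

  -- Relative to `a`, pairs inside `V₀` lose one and crossing pairs gain one; the loss stands on the
  -- left to avoid subtraction.
  sum-weight : ∀ xs → sum (pairValues weight xs) + tri (size₀ part xs) ≡ tri (length xs) * a + size₀ part xs * size₁ part xs
  sum-weight []       = refl
  sum-weight (x ∷ xs) with part x
  ... | zero     = begin
    sum (map row xs ++ pairValues weight xs) + (k + tri k)   ≡⟨ cong (_+ (k + tri k)) (sum-++ (map row xs) _) ⟩
    sum (map row xs) + S + (k + tri k)                       ≡⟨ regroup (sum (map row xs)) S k (tri k) ⟩
    (sum (map row xs) + k) + (S + tri k)                     ≡⟨ cong₂ _+_ (sum-row₀ xs) (sum-weight xs) ⟩
    (n * a + l) + (tri n * a + k * l)                        ≡⟨ collect n a l (tri n) k ⟩
    (n + tri n) * a + (l + k * l) ∎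
    where
    open ≡-Reasoning
    row : A → ℕ
    row y = partWeight {2} a 1 zero (part y)
    S k l n : ℕ
    S = sum (pairValues weight xs)
    k = size₀ part xs
    l = size₁ part xs
    n = length xs
    regroup : ∀ r s k t → r + s + (k + t) ≡ (r + k) + (s + t)
    regroup = solve-∀
    collect : ∀ n a l t k → (n * a + l) + (t * a + k * l) ≡ (n + t) * a + (l + k * l)
    collect = solve-∀
  ... | suc zero = begin
    sum (map row xs ++ pairValues weight xs) + tri k         ≡⟨ cong (_+ tri k) (sum-++ (map row xs) _) ⟩
    sum (map row xs) + S + tri k                             ≡⟨ +-assoc (sum (map row xs)) S (tri k) ⟩
    sum (map row xs) + (S + tri k)                           ≡⟨ cong₂ _+_ (sum-row₁ xs) (sum-weight xs) ⟩
    (n * a + k) + (tri n * a + k * l)                        ≡⟨ collect n a l (tri n) k ⟩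
    (n + tri n) * a + k * suc l ∎
    where
    open ≡-Reasoning
    row : A → ℕ
    row y = partWeight {2} a 1 (suc zero) (part y)
    S k l n : ℕ
    S = sum (pairValues weight xs)
    k = size₀ part xs
    l = size₁ part xs
    n = length xs
    collect : ∀ n a l t k → (n * a + k) + (t * a + k * l) ≡ (n + t) * a + k * (1 + l)
    collect = solve-∀

  -- The constant 7 is the maximum of `k * l - tri k` over `k + l = 6`, reached at `k = 2`.
  6-set-sum : ∀ xs → length xs ≡ 6 → sum (pairValues weight xs) ≤ 15 * a + 7
  6-set-sum xs |xs|≡6 = +-cancelʳ-≤ (tri (size₀ part xs)) _ _ (begin
    sum (pairValues weight xs) + tri (size₀ part xs)         ≡⟨ sum-weight xs ⟩
    tri (length xs) * a + size₀ part xs * size₁ part xs           ≡⟨ cong (λ n → tri n * a + size₀ part xs * size₁ part xs) |xs|≡6 ⟩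
    15 * a + size₀ part xs * size₁ part xs                        ≤⟨ +-monoʳ-≤ (15 * a) (six (size₀ part xs) (size₁ part xs) (trans (size₀+size₁ part xs) |xs|≡6)) ⟩
    15 * a + (7 + tri (size₀ part xs))                       ≡⟨ +-assoc (15 * a) 7 _ ⟨
    15 * a + 7 + tri (size₀ part xs) ∎)
    where
    open ≤-Reasoning
    six : ∀ k l → k + l ≡ 6 → k * l ≤ 7 + tri k
    six 0 _ refl = ≤ᵇ⇒≤ _ _ _
    six 1 _ refl = ≤ᵇ⇒≤ _ _ _
    six 2 _ refl = ≤ᵇ⇒≤ _ _ _
    six 3 _ refl = ≤ᵇ⇒≤ _ _ _
    six 4 _ refl = ≤ᵇ⇒≤ _ _ _
    six 5 _ refl = ≤ᵇ⇒≤ _ _ _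
    six 6 _ refl = ≤ᵇ⇒≤ _ _ _

-- The upper bound, by induction on the number of vertices

module Bound (b : ℕ) (1≤b : 1 ≤ b) {A : Set} (_≟_ : DecidableEquality A) (w : A → A → ℕ)
  (w-sym : ∀ x y → w x y ≡ w y x) (w-diag : ∀ x → w x x ≡ suc b)
  (6-set : ∀ X → Unique X → length X ≡ 6 → sum (pairValues w X) ≤ 15 * suc b + 7) where

  a : ℕ
  a = suc b

  open Powers b a (suc a) refl refl 1≤b

  Π : List A → ℕ
  Π V = product (pairValues w V)

  c : A → A → ℤ
  c x y = + w x y ℤ.- + a

  c-sym : ∀ x y → c x y ≡ c y x
  c-sym x y = cong (λ v → + v ℤ.- + a) (w-sym x y)

  c-refl : ∀ x → c x x ≡ 0ℤ
  c-refl x = trans (cong (λ v → + v ℤ.- + a) (w-diag x)) (ℤ.+-inverseʳ (+ a))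

  open Structure _≟_ c c-sym c-refl using (pairSum)

  ∑-c : ∀ x ys → ∑ ys (c x) ≡ + sum (map (w x) ys) ℤ.- + (length ys * a)
  ∑-c x []       = refl
  ∑-c x (y ∷ ys) = trans (cong (ℤ._+_ (c x y)) (∑-c x ys)) (regroup (+ w x y) (+ a) (+ sum (map (w x) ys)) (+ (length ys * a)))
    where
    regroup : ∀ i j k l → i ℤ.- j ℤ.+ (k ℤ.- l) ≡ i ℤ.+ k ℤ.- (j ℤ.+ l)
    regroup = solve-∀-ℤ

  pairSum-c : ∀ X → pairSum X ≡ + sum (pairValues w X) ℤ.- + (tri (length X) * a)
  pairSum-c []       = refl
  pairSum-c (x ∷ xs) = begin
    ∑ xs (c x) ℤ.+ pairSum xs
      ≡⟨ cong₂ ℤ._+_ (∑-c x xs) (pairSum-c xs) ⟩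
    (+ r ℤ.- + (n * a)) ℤ.+ (+ s ℤ.- + (tri n * a))
      ≡⟨ regroup (+ r) (+ (n * a)) (+ s) (+ (tri n * a)) ⟩
    + (r + s) ℤ.- + (n * a + tri n * a)
      ≡⟨ cong₂ (λ i j → + i ℤ.- + j) (sum-++ (map (w x) xs) (pairValues w xs)) (*-distribʳ-+ a n (tri n)) ⟨
    + sum (map (w x) xs ++ pairValues w xs) ℤ.- + ((n + tri n) * a) ∎
    where
    open ≡-Reasoning
    r s n : ℕ
    r = sum (map (w x) xs)
    s = sum (pairValues w xs)
    n = length xs
    regroup : ∀ i j k l → i ℤ.- j ℤ.+ (k ℤ.- l) ≡ i ℤ.+ k ℤ.- (j ℤ.+ l)
    regroup = solve-∀-ℤ

  ≤⇒-≤ : ∀ i j k → i ≤ j + k → + i ℤ.- + j ℤ.≤ + k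
  ≤⇒-≤ i j k p = ℤ.≤-trans (ℤ.+-monoˡ-≤ (ℤ.- + j) (+≤+ p)) (ℤ.≤-reflexive (cancel (+ j) (+ k)))
    where
    cancel : ∀ j k → j ℤ.+ k ℤ.- j ≡ k
    cancel = solve-∀-ℤ

  -≤⇒≤ : ∀ i j k → + i ℤ.- + j ℤ.≤ k → + i ℤ.≤ k ℤ.+ + j
  -≤⇒≤ i j k p = ℤ.≤-trans (ℤ.≤-reflexive (cancel (+ i) (+ j))) (ℤ.+-monoˡ-≤ (+ j) p)
    where
    cancel : ∀ i j → i ≡ i ℤ.- j ℤ.+ j
    cancel = solve-∀-ℤ

  6-sets : ∀ V → Unique V → ∀ X Y → V ↭ X ++ Y → length X ≡ 6 → pairSum X ℤ.≤ + 7
  6-sets V V-unique X Y V↭ |X|≡6 = subst (ℤ._≤ + 7) (sym (pairSum-c X))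
    (≤⇒-≤ (sum (pairValues w X)) (tri (length X) * a) 7
      (subst (λ n → sum (pairValues w X) ≤ tri n * a + 7) (sym |X|≡6)
        (6-set X (unique-++ˡ X (Unique-resp-↭ V↭ V-unique)) |X|≡6)))

  -- The constant 9000 is any K with 8 * 31² ≤ K (extremal-step) and 14² + 9 * 14 + K ≤ 388 * 33 (balanced-size).
  Extremal Loose : ℕ → ℕ → Set
  Extremal n N = ∃₂ λ k l → k + l ≡ n × N ≤ T k l
  Loose    n N = ∃ λ X → 8 * X ≤ n * n + 9 * n + 9000 × Excess N (tri n) X

  -- The integer part of `n / 4 + 1`. A degree above it is at least `suc (threshold n)`, which
  -- serves as `τ` and satisfies `n + 5 ≤ 4τ`.
  threshold : ℕ → ℕ
  threshold n = (n + 4) / 4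

  threshold-≤ : ∀ n → 4 * threshold n ≤ n + 4
  threshold-≤ n = ≤-trans (≤-reflexive (*-comm 4 (threshold n))) (m/n*n≤m (n + 4) 4)

  threshold-≥ : ∀ n → n + 5 ≤ 4 * suc (threshold n)
  threshold-≥ n = begin
    n + 5                                ≡⟨ +-suc n 4 ⟩
    suc (n + 4)                          ≡⟨ cong suc (m≡m%n+[m/n]*n (n + 4) 4) ⟩
    suc ((n + 4) % 4 + threshold n * 4)  ≤⟨ +-monoˡ-≤ (threshold n * 4) (m%n<n (n + 4) 4) ⟩
    4 + threshold n * 4                  ≡⟨ *-comm (suc (threshold n)) 4 ⟩
    4 * suc (threshold n) ∎
    where open ≤-Reasoning

  -- The weights are compared pair by pair with those of the partition into `Large` vertices and the
  -- rest.
  structured : ∀ V → Unique V → 7 ≤ length V →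
               (∀ {x} → x ∈ V → + suc (threshold (length V)) ℤ.≤ ∑ V (c x)) → Extremal (length V) (Π V)
  structured V V-unique 7≤n min-degree = size₀ part V , size₁ part V , size₀+size₁ part V ,
    ≤-trans (product-pairValues-mono (unique⇒allPairs V V-unique bound)) (≤-reflexive (P.product-weight V))
    where
    τ : ℤ
    τ = + suc (threshold (length V))
    n+5≤4τ : + length V ℤ.+ + 5 ℤ.≤ + 4 ℤ.* τ
    n+5≤4τ = ℤ.≤-trans (+≤+ (threshold-≥ (length V))) (ℤ.≤-reflexive (ℤ.pos-* 4 (suc (threshold (length V)))))
    3≤τ : + 3 ℤ.≤ τ
    3≤τ = +≤+ (s≤s (/-monoˡ-≤ 4 (+-monoˡ-≤ 4 7≤n)))
    open Structure _≟_ c c-sym c-refl using (module Configuration)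
    open Configuration V V-unique τ 3≤τ (+≤+ 7≤n) n+5≤4τ (6-sets V V-unique) min-degree
    part : A → Fin 2
    part x with large? x
    ... | yes _ = zero
    ... | no _  = suc zero
    module P = Partition b 1≤b part
    bound : ∀ {x y} → x ∈ V → y ∈ V → x ≢ y → w x y ≤ P.weight x y
    bound {x} {y} x∈V y∈V x≢y with large? x | large? y
    ... | yes p | yes q = ℤ.drop‿+≤+ (-≤⇒≤ (w x y) a -1ℤ (large-clique x∈V y∈V x≢y p q))
    ... | yes _ | no _  = ℤ.drop‿+≤+ (-≤⇒≤ (w x y) a 1ℤ (c≤1 x∈V y∈V))
    ... | no _  | yes _ = ℤ.drop‿+≤+ (-≤⇒≤ (w x y) a 1ℤ (c≤1 x∈V y∈V))
    ... | no p  | no q  = ℤ.drop‿+≤+ (-≤⇒≤ (w x y) a 0ℤ (c≤0 x∈V y∈V (small-independent x∈V y∈V p q)))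

  row-excess : ∀ {V v V′} s → V ↭ v ∷ V′ → ∑ V (c v) ℤ.≤ + s → Excess (product (map (w v) V′)) (length V′) s
  row-excess {V} {v} {V′} s V↭ low = subst (λ n → Excess (product row) n s) (length-map (w v) V′)
    (product-excess row s (subst (λ n → sum row ≤ n * a + s) (sym (length-map (w v) V′))
      (≤-trans (ℤ.drop‿+≤+ (-≤⇒≤ (sum row) (length V′ * a) (+ s) low′)) (≤-reflexive (+-comm s (length V′ * a))))))
    where
    row : List ℕ
    row = map (w v) V′
    low′ : + sum row ℤ.- + (length V′ * a) ℤ.≤ + s
    low′ = subst (ℤ._≤ + s) (trans (∑-↭ (c v) V↭)
      (trans (cong (ℤ._+ ∑ V′ (c v)) (c-refl v)) (trans (ℤ.+-identityˡ _) (∑-c v V′)))) low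

  -- The bound `n * n + 9 * n` grows by exactly `2 * (suc n + 4)`, twice what is allowed for
  -- `4 * s`; this fixes the coefficient 9.
  loose-step : ∀ {n D N} s → 4 * s ≤ suc n + 4 → Excess D n s → Loose n N → Loose (suc n) (D * N)
  loose-step {n} {D} {N} s 4s≤ p (X , 8X≤ , q) = s + X , size , Excess-* {D} {n} {s} {N} {tri n} {X} p q
    where
    open ≤-Reasoning
    expand : ∀ n K → 2 * ((1 + n) + 4) + (n * n + 9 * n + K) ≡ (1 + n) * (1 + n) + 9 * (1 + n) + K
    expand = solve-∀
    split : ∀ s X → 8 * (s + X) ≡ 2 * (4 * s) + 8 * X
    split = solve-∀
    size : 8 * (s + X) ≤ suc n * suc n + 9 * suc n + 9000
    size = begin
      8 * (s + X)                                  ≡⟨ split s X ⟩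
      2 * (4 * s) + 8 * X                          ≤⟨ +-mono-≤ (*-monoʳ-≤ 2 4s≤) 8X≤ ⟩
      2 * (suc n + 4) + (n * n + 9 * n + 9000)     ≡⟨ expand n 9000 ⟩
      suc n * suc n + 9 * suc n + 9000 ∎

  -- `T-grow` works from 32 vertices on. Below that the shape is forgotten and `T k l` is recorded
  -- only by its excess `k * l`.
  extremal-step : ∀ {n D N} s → 4 * s ≤ suc n + 4 → Excess D n s → Extremal n N →
                  Extremal (suc n) (D * N) ⊎ Loose (suc n) (D * N)
  extremal-step {n} {D} {N} s 4s≤ p (k , l , k+l≡n , N≤T) with 32 ≤? n
  ... | yes 32≤n =
    let k′ , l′ , k′+l′ , DT≤T = T-grow {D} k l s (subst (32 ≤_) (sym k+l≡n) 32≤n)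
          (subst (λ n → 4 * s ≤ 5 + n) (sym k+l≡n) (≤-trans 4s≤ (≤-reflexive (cong suc (+-comm n 4)))))
          (subst (λ n → Excess D n s) (sym k+l≡n) p)
    in inj₁ (k′ , l′ , trans k′+l′ (cong suc k+l≡n) , ≤-trans (*-monoʳ-≤ D N≤T) DT≤T)
  ... | no 32≰n = inj₂ (loose-step {n} {D} {N} s 4s≤ p (k * l , small , Excess-≤ {N} {T k l} {tri n} {k * l} N≤T
                    (subst (λ n → Excess (T k l) (tri n) (k * l)) k+l≡n (T-excess k l))))
    where
    open ≤-Reasoning
    n≤31 : n ≤ 31
    n≤31 = ≤-pred (≰⇒> 32≰n)
    small : 8 * (k * l) ≤ n * n + 9 * n + 9000
    small = begin
      8 * (k * l)             ≤⟨ *-monoʳ-≤ 8 (*-mono-≤ (≤-trans (m≤m+n k l) (≤-reflexive k+l≡n)) (≤-trans (m≤n+m l k) (≤-reflexive k+l≡n))) ⟩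
      8 * (n * n)             ≤⟨ *-monoʳ-≤ 8 (*-mono-≤ n≤31 n≤31) ⟩
      8 * (31 * 31)           ≤⟨ ≤ᵇ⇒≤ (8 * (31 * 31)) 9000 _ ⟩
      9000                    ≤⟨ m≤n+m 9000 (n * n + 9 * n) ⟩
      n * n + 9 * n + 9000 ∎

  -- The induction starts at six vertices, where the whole set is one 6-set of excess at most 7. A
  -- `Loose` bound survives deletions until a set with all degrees large makes the bound `Extremal`
  -- again.
  extremal-or-loose : ∀ m V → Unique V → length V ≡ 6 + m → Extremal (length V) (Π V) ⊎ Loose (length V) (Π V)
  extremal-or-loose zero V V-unique |V|≡6 = inj₂ (7 , ≤-trans (≤ᵇ⇒≤ (8 * 7) 9000 _) (m≤n+m 9000 _) ,
    subst (λ n → Excess (Π V) n 7) (length-pairValues w V) (product-excess (pairValues w V) 7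
      (subst (λ n → sum (pairValues w V) ≤ n * a + 7) (sym (trans (length-pairValues w V) (cong tri |V|≡6)))
        (6-set V V-unique |V|≡6))))
  extremal-or-loose (suc m) V V-unique |V|≡ with any? (λ v → ∑ V (c v) ℤ.≤? + threshold (length V)) V
  ... | no none  = inj₁ (structured V V-unique (subst (7 ≤_) (sym |V|≡) (m≤m+n 7 m))
                     (λ x∈V → ≰⇒suc≤ (λ low → none (Any.map (λ { refl → low }) x∈V))))
  ... | yes some with v , v∈V , low ← find some with V′ , V↭ ← ∈-split v∈V =
    subst (λ N → Extremal (length V) N ⊎ Loose (length V) N) (sym ΠV≡)
      (subst (λ n → Extremal n (D * Π V′) ⊎ Loose n (D * Π V′)) (sym |V|≡1+|V′|) step)
    where
    D s : ℕ
    D = product (map (w v) V′)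
    s = threshold (length V)
    |V|≡1+|V′| : length V ≡ suc (length V′)
    |V|≡1+|V′| = ↭-length V↭
    ΠV≡ : Π V ≡ D * Π V′
    ΠV≡ = trans (product-↭ (pairValues-↭ w w-sym V↭)) (product-++ (map (w v) V′) (pairValues w V′))
    V′-unique : Unique V′
    V′-unique with _ ∷ u ← Unique-resp-↭ V↭ V-unique = u
    4s≤ : 4 * s ≤ suc (length V′) + 4
    4s≤ = subst (λ n → 4 * s ≤ n + 4) |V|≡1+|V′| (threshold-≤ (length V))
    step : Extremal (suc (length V′)) (D * Π V′) ⊎ Loose (suc (length V′)) (D * Π V′)
    step with extremal-or-loose m V′ V′-unique (suc-injective (trans (sym |V|≡1+|V′|) |V|≡))
    ... | inj₁ extremal = extremal-step {D = D} s 4s≤ (row-excess s V↭ low) extremal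
    ... | inj₂ loose    = inj₂ (loose-step {D = D} {Π V′} s 4s≤ (row-excess s V↭ low) loose)

  extremal : ∀ V → Unique V → 503 ≤ length V → Extremal (length V) (Π V)
  extremal V V-unique 503≤n with extremal-or-loose (length V ∸ 6) V V-unique (sym (m+[n∸m]≡n (≤-trans (≤ᵇ⇒≤ 6 503 _) 503≤n)))
  ... | inj₁ p               = p
  ... | inj₂ (X , 8X≤ , p)   = excess⇒≤T {Π V} (length V) X 503≤n 8X≤ p

-- From multigraphs on `Fin n` to lists of vertices

private variable
  n : ℕ

pairValues-cong : ∀ {f g : A → A → ℕ} {xs} → AllPairs (λ x y → f x y ≡ g x y) xs → pairValues f xs ≡ pairValues g xs
pairValues-cong []       = refl
pairValues-cong (p ∷ ps) = cong₂ _++_ (map-cong-local p) (pairValues-cong ps)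

sum-restrict : ∀ (q : A → Bool) (h : A → A → ℕ) xs →
  sum (pairValues (λ x y → if q x ∧ q y then h x y else 0) xs) ≡ sum (pairValues h (filter (λ x → q x Bool.≟ true) xs))
sum-restrict q h []       = refl
sum-restrict q h (x ∷ xs) with q x
... | true  = trans (sum-++ (map _ xs) _) (trans (cong₂ _+_ (row xs) (sum-restrict q h xs))
                (sym (sum-++ (map (h x) (filter (λ y → q y Bool.≟ true) xs)) _)))
  where
  row : ∀ ys → sum (map (λ y → if q y then h x y else 0) ys) ≡ sum (map (h x) (filter (λ y → q y Bool.≟ true) ys))
  row []       = refl
  row (y ∷ ys) with q y
  ... | true  = cong (_+_ (h x y)) (row ys)
  ... | false = row ys
... | false = trans (sum-++ (map _ xs) _) (cong₂ _+_ (zeros xs) (sum-restrict q h xs))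
  where
  zeros : ∀ (ys : List A) → sum (map (λ _ → 0) ys) ≡ 0
  zeros []       = refl
  zeros (y ∷ ys) = zeros ys

pairsOf : List (Fin n) → List (Fin n × Fin n)
pairsOf xs = concatMap (λ i → map (i ,_) (filter (λ j → i <? j) xs)) xs

-- In a sorted list the filter for the head `x` drops exactly `x`, and the filter for any later `i`
-- drops `x` too, so the recursion passes to the tail.
map-pairsOf : ∀ (f : Fin n × Fin n → ℕ) {xs} → AllPairs _<ᶠ_ xs → map f (pairsOf xs) ≡ pairValues (λ i j → f (i , j)) xs
map-pairsOf f []                       = refl
map-pairsOf f {x ∷ xs} (x< ∷ sorted) = trans (map-++ f (map (x ,_) (filter (x <?_) (x ∷ xs))) _)
  (cong₂ _++_
    (trans (sym (map-∘ (filter (x <?_) (x ∷ xs)))) (cong (map (λ j → f (x , j)))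
      (trans (filter-reject (x <?_) (Fin.<-irrefl refl)) (filter-all (x <?_) x<))))
    (trans (cong (map f ∘ concat) (map-cong-local (All.map (λ {i} x<i →
        cong (map (i ,_)) (filter-reject (i <?_) (Fin.<-asym x<i))) x<)))
      (map-pairsOf f sorted)))

allFin-sorted : ∀ n → AllPairs _<ᶠ_ (allFin n)
allFin-sorted n = tabulate⁺-< id

members : Subset n → List (Fin n)
members {n} X = filter (λ i → lookup X i Bool.≟ true) (allFin n)

module _ (w h : Multigraph n) (w≡h : ∀ i j → i <ᶠ j → w i j ≡ h i j) where

  -- Below the diagonal `w` is arbitrary, so it is exchanged for an `h` that agrees with it above:
  -- the symmetrised multigraph or the weight of a partition.
  P≡product : P w ≡ product (pairValues h (allFin n))
  P≡product = cong product (trans (map-pairsOf _ (allFin-sorted n))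
    (pairValues-cong (AllPairs.map (w≡h _ _) (allFin-sorted n))))

  e≡sum : ∀ X → e w X ≡ sum (pairValues h (members X))
  e≡sum X = trans (cong sum (trans (map-pairsOf _ (allFin-sorted n)) (pairValues-cong (AllPairs.map
      (λ {i} {j} i<j → cong (λ v → if lookup X i ∧ lookup X j then v else 0) (w≡h i j i<j)) (allFin-sorted n)))))
    (sum-restrict (lookup X) h (allFin n))

-- `f` and `q` are general so that the induction can pass from `f` to `f ∘ suc`.
∣∣≡length : ∀ {m} (X : Subset m) (f : Fin m → A) (q : A → Bool) → (∀ i → q (f i) ≡ lookup X i) →
            ∣ X ∣ ≡ length (filter (λ x → q x Bool.≟ true) (tabulate f))
∣∣≡length []          f q eq = refl
∣∣≡length (true ∷ X)  f q eq with q (f zero) | eq zero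
... | true  | _ = cong suc (∣∣≡length X (f ∘ suc) q (eq ∘ suc))
∣∣≡length (false ∷ X) f q eq with q (f zero) | eq zero
... | false | _ = ∣∣≡length X (f ∘ suc) q (eq ∘ suc)

fromList : List (Fin n) → Subset n
fromList Xs = Vec.tabulate (λ i → does (i ∈? Xs))
  where open DecMembership _≟ᶠ_ using (_∈?_)

members-fromList : ∀ (Xs : List (Fin n)) → Unique Xs → members (fromList Xs) ↭ Xs
members-fromList {n} Xs Xs-unique with Ys , p ← ⊆-split Xs Xs-unique (λ {x} _ → ∈-allFin x) =
  ↭-trans (filter-↭ _ p) (↭-reflexive (trans (filter-++ _ Xs Ys)
    (trans (cong₂ _++_ (filter-all _ (All.tabulate inside)) (filter-none _ (All.tabulate outside))) (++-identityʳ Xs))))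
  where
  open DecMembership _≟ᶠ_ using (_∈?_)
  inside : ∀ {i} → i ∈ Xs → lookup (fromList Xs) i ≡ true
  inside {i} i∈Xs = trans (lookup∘tabulate _ i) (dec-true (i ∈? Xs) i∈Xs)
  outside : ∀ {i} → i ∈ Ys → lookup (fromList Xs) i ≢ true
  outside {i} i∈Ys eq with () ← trans (sym eq) (trans (lookup∘tabulate _ i) (dec-false (i ∈? Xs)
    (λ i∈Xs → unique-disjoint Xs (Unique-resp-↭ p (allFin⁺ n)) i∈Xs i∈Ys)))

module Symmetrised (a : ℕ) (w : Multigraph n) where

  -- The diagonal value `a` gives each vertex excess 0 with itself, so degrees may be summed over
  -- all vertices.
  ŵ : Multigraph n
  ŵ i j with Fin.<-cmp i j
  ... | tri< _ _ _ = w i j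
  ... | tri≈ _ _ _ = a
  ... | tri> _ _ _ = w j i

  ŵ-sym : ∀ i j → ŵ i j ≡ ŵ j i
  ŵ-sym i j with Fin.<-cmp i j | Fin.<-cmp j i
  ... | tri< _ _ _   | tri> _ _ _   = refl
  ... | tri≈ _ _ _   | tri≈ _ _ _   = refl
  ... | tri> _ _ _   | tri< _ _ _   = refl
  ... | tri< i<j _ _ | tri< j<i _ _ = contradiction j<i (Fin.<-asym i<j)
  ... | tri< _ i≢j _ | tri≈ _ j≡i _ = contradiction (sym j≡i) i≢j
  ... | tri≈ _ i≡j _ | tri< _ j≢i _ = contradiction (sym i≡j) j≢i
  ... | tri≈ _ i≡j _ | tri> _ j≢i _ = contradiction (sym i≡j) j≢i
  ... | tri> _ i≢j _ | tri≈ _ j≡i _ = contradiction (sym j≡i) i≢j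
  ... | tri> _ _ j<i | tri> _ _ i<j = contradiction j<i (Fin.<-asym i<j)

  ŵ-diag : ∀ i → ŵ i i ≡ a
  ŵ-diag i with Fin.<-cmp i i
  ... | tri< _ i≢i _ = contradiction refl i≢i
  ... | tri≈ _ _ _   = refl
  ... | tri> _ i≢i _ = contradiction refl i≢i

  w≡ŵ : ∀ i j → i <ᶠ j → w i j ≡ ŵ i j
  w≡ŵ i j i<j with Fin.<-cmp i j
  ... | tri< _ _ _   = refl
  ... | tri≈ i≮j _ _ = contradiction i<j i≮j
  ... | tri> i≮j _ _ = contradiction i<j i≮j

  6-set : ∀ {q} → InF n 6 q w → ∀ X → Unique X → length X ≡ 6 → sum (pairValues ŵ X) ≤ q
  6-set {q} w∈F X X-unique |X|≡6 = subst (_≤ q)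
    (trans (e≡sum w ŵ w≡ŵ (fromList X)) (sum-↭ (pairValues-↭ ŵ ŵ-sym (members-fromList X X-unique))))
    (w∈F (fromList X) (trans (∣∣≡length (fromList X) id (lookup (fromList X)) (λ _ → refl))
      (trans (↭-length (members-fromList X X-unique)) |X|≡6)))

-- Attaining the bound and maximising over the part sizes

first : ℕ → Fin n → Fin 2
first zero    _       = suc zero
first (suc k) zero    = zero
first (suc k) (suc i) = first k i

size₀-tabulate : ∀ {m} (part : A → Fin 2) (f : Fin m → A) → size₀ part (tabulate f) ≡ size₀ (part ∘ f) (allFin m)
size₀-tabulate {m = zero}  part f = refl
size₀-tabulate {m = suc m} part f with part (f zero)
... | zero     = cong suc (trans (size₀-tabulate part (f ∘ suc)) (sym (size₀-tabulate (part ∘ f) suc)))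
... | suc zero = trans (size₀-tabulate part (f ∘ suc)) (sym (size₀-tabulate (part ∘ f) suc))

size₀-first : ∀ k l → size₀ (first k) (allFin (k + l)) ≡ k
size₀-first zero    l = none (allFin l)
  where
  none : ∀ (xs : List (Fin l)) → size₀ (first 0) xs ≡ 0
  none []       = refl
  none (x ∷ xs) = none xs
size₀-first (suc k) l = cong suc (trans (size₀-tabulate {m = k + l} (first (suc k)) suc) (size₀-first k l))

argmax : ∀ (f : ℕ → ℕ) n → ∃ λ k → k ≤ n × (∀ j → j ≤ n → f j ≤ f k)
argmax f zero    = 0 , z≤n , λ { zero _ → ≤-refl }
argmax f (suc n) with k , k≤n , max ← argmax f n with f k ≤? f (suc n)
... | yes fk≤ = suc n , ≤-refl , λ j j≤1+n → bound j (m≤n⇒m<n∨m≡n j≤1+n)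
  where
  bound : ∀ j → j < suc n ⊎ j ≡ suc n → f j ≤ f (suc n)
  bound j (inj₁ j<1+n) = ≤-trans (max j (≤-pred j<1+n)) fk≤
  bound j (inj₂ refl)  = ≤-refl
... | no fk≰ = k , m≤n⇒m≤1+n k≤n , λ j j≤1+n → bound j (m≤n⇒m<n∨m≡n j≤1+n)
  where
  bound : ∀ j → j < suc n ⊎ j ≡ suc n → f j ≤ f k
  bound j (inj₁ j<1+n) = max j (≤-pred j<1+n)
  bound j (inj₂ refl)  = <⇒≤ (≰⇒> fk≰)

module _ (b : ℕ) (1≤b : 1 ≤ b) where

  open Powers b (suc b) (suc (suc b)) refl refl 1≤b using (T)

  InT⇒InF : ∀ {w} → InT 2 1 (suc b) n w → InF n 6 ((6 C 2) * suc b + 7) w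
  InT⇒InF {n} {w} (part , w≡) X |X|≡6 = subst (_≤ 15 * suc b + 7) (sym (e≡sum w weight w≡ X))
    (6-set-sum (members X) (trans (sym (∣∣≡length X id (lookup X) (λ _ → refl))) |X|≡6))
    where open Partition b 1≤b part

  InT⇒P≡T : ∀ {w} → InT 2 1 (suc b) n w → ∃₂ λ k l → k + l ≡ n × P w ≡ T k l
  InT⇒P≡T {n} {w} (part , w≡) = size₀ part (allFin n) , size₁ part (allFin n) ,
    trans (size₀+size₁ part (allFin n)) (length-tabulate id) ,
    trans (P≡product w weight w≡) (product-weight (allFin n))
    where open Partition b 1≤b part

  InF⇒P≤T : ∀ {w} → 503 ≤ n → InF n 6 ((6 C 2) * suc b + 7) w → ∃₂ λ k l → k + l ≡ n × P w ≤ T k l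
  InF⇒P≤T {n} {w} 503≤n w∈F =
    let k , l , k+l≡ , Π≤T = extremal (allFin n) (allFin⁺ n) (subst (503 ≤_) (sym (length-tabulate id)) 503≤n)
    in k , l , trans k+l≡ (length-tabulate id) , subst (_≤ T k l) (sym (P≡product w ŵ w≡ŵ)) Π≤T
    where
    open Symmetrised (suc b) w
    open Bound b 1≤b _≟ᶠ_ ŵ ŵ-sym ŵ-diag (6-set w∈F)

  attained : ∀ k l → k + l ≡ n → ∃[ w ] (InT 2 1 (suc b) n w × P w ≡ T k l)
  attained k l refl = weight , (first k , λ _ _ _ → refl) ,
    trans (P≡product weight weight (λ _ _ _ → refl)) (trans (product-weight (allFin (k + l))) (cong₂ T (size₀-first k l) size₁≡l))
    where
    open Partition b 1≤b (first {k + l} k)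
    size₁≡l : size₁ (first k) (allFin (k + l)) ≡ l
    size₁≡l = +-cancelˡ-≡ k _ _ (trans (cong (_+ size₁ (first k) (allFin (k + l))) (sym (size₀-first k l)))
      (trans (size₀+size₁ (first k) (allFin (k + l))) (length-tabulate id)))

  largest-T : ∀ n → ∃₂ λ k l → k + l ≡ n × (∀ k′ l′ → k′ + l′ ≡ n → T k′ l′ ≤ T k l)
  largest-T n with k , k≤n , max ← argmax (λ k → T k (n ∸ k)) n = k , n ∸ k , m+[n∸m]≡n k≤n , λ k′ l′ eq →
    subst (λ l → T k′ l ≤ T k (n ∸ k)) (trans (cong (_∸ k′) (sym eq)) (m+n∸m≡n k′ l′))
      (max k′ (≤-trans (m≤m+n k′ l′) (≤-reflexive eq)))

theorem3p7 : (a n : ℕ) → 2 ≤ a → 503 ≤ n →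
    ∃[ v ] (IsMaxP (InF n 6 ((6 C 2) * a + 7)) v × IsMaxP (InT 2 1 a n) v)
theorem3p7 (suc b) n (s≤s 1≤b) 503≤n =
  -- Both maxima are the largest `T k l`, and the same `w` attains both because `InT⇒InF` places it
  -- in the larger family.
  let k , l , k+l≡n , max = largest-T b 1≤b n
      w , w∈T , Pw≡ = attained b 1≤b k l k+l≡n
  in _ , ((w , InT⇒InF b 1≤b w∈T , Pw≡) , λ u u∈F →
           let k′ , l′ , eq , Pu≤ = InF⇒P≤T b 1≤b 503≤n u∈F in ≤-trans Pu≤ (max k′ l′ eq)) ,
         ((w , w∈T , Pw≡) , λ u u∈T →
           let k′ , l′ , eq , Pu≡ = InT⇒P≡T b 1≤b u∈T in ≤-trans (≤-reflexive Pu≡) (max k′ l′ eq))
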